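{- In the Call-by-Value probabilistic $\lambda$-calculus (as defined in the context), for each multi-distribution $\mathbf m$: 1. $[\![\mathbf m]\!]$ is defined, i.e. $\mathrm{Lim}_{\mathrm{obs}_{\mathrm{Nnf}}}(\mathbf m,\Rightarrow)$ has a greatest element; 2. for every subdistribution $\mathbf r$: $\mathbf m\Rrightarrow_E^{\mathrm{obs}_{\mathrm{Nnf}}}\mathbf r$ if and only if $\mathbf r=[\![\mathbf m]\!]$. Hence $\Rrightarrow_E$ is an $\mathrm{obs}_{\mathrm{Nnf}}$-normalizing strategy for $\Rightarrow$.
   Context: Terms $\Lambda_\oplus$: $M::=x\mid\lambda x.M\mid MM\mid M\oplus M$; values $V::=x\mid\lambda x.M$. Contexts $C::=[\,]\mid MC\mid CM\mid\lambda x.C\mid C\oplus M\mid M\oplus C$; weak contexts $W::=[\,]\mid WM\mid MW$. A multi-distribution is a finite multiset $[p_iM_i]_{i\in I}$ with $p_i\in(0,1]$, $\sum_ip_i\le1$; $+$ is multiset union, $q\cdot[p_iM_i]_i=[(qp_i)M_i]_i$, $[M]:=[1M]$. $C[(\lambda x.M)V]\to_{\beta_v}[C[M\{V/x\}]]$; $W[M\oplus N]\to_\oplus[\tfrac12W[M],\tfrac12W[N]]$; $\to:=\to_{\beta_v}\cup\to_\oplus$; surface reduction $\to_s$ is $\to_\oplus$ together with the closure of $\beta_v$ under weak contexts. $M$ is $\to$-normal (surface-normal) if no $\mathbf m$ with $M\to\mathbf m$ ($M\to_s\mathbf m$); $\mathrm{Nnf}$ is the set of $\to$-normal terms. Lifting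 $\Rightarrow_r$ of $r$: least relation with $[M]\Rightarrow_r[M]$; $[M]\Rightarrow_r\mathbf m$ if $M\,r\,\mathbf m$; $[p_iM_i]_{i\in I}\Rightarrow_r\sum_ip_i\cdot\mathbf m_i$ if $[M_i]\Rightarrow_r\mathbf m_i$ for all $i$. Full lifting $\Rrightarrow_r$: same, but $[M]\Rrightarrow_r[M]$ only when $M$ is $\to$-normal. $\Rightarrow$ is the lifting of $\to$. Let $\rightsquigarrow_U$ be the unbiased iteration of weak $\beta_v$-reduction on $\Lambda_\oplus$: if $M\to_wM'$ (closure of $\beta_v$ under weak contexts) then $M\rightsquigarrow_UM'$; if $M$ is $\to_w$-normal: $\lambda x.P\rightsquigarrow_U\lambda x.P'$, $PQ\rightsquigarrow_UP'Q$, $PQ\rightsquigarrow_UPQ'$, $P\oplus Q\rightsquigarrow_UP'\oplus Q$, $P\oplus Q\rightsquigarrow_UP\oplus Q'$ whenever $P\rightsquigarrow_UP'$, resp. $Q\rightsquigarrow_UQ'$. $\rightsquigarrow_E$: if $M$ is not surface-normal and $M\to_s\mathbf m$ then $M\rightsquigarrow_E\mathbf m$; if $M$ is surface-normal and $M\rightsquigarrow_UM'$ then $M\rightsquigarrow_E[M']$; $\Rrightarrow_E$ is its full lifting. $\mathrm{obs}_{\mathrm{Nnf}}([p_iM_i]_{i\in I})$ is the subdistribution $\mu$ on $\mathrm{Nnf}$ with $\mu(N)=\sum_{i:\,M_i=N}p_i$, ordered pointwise. For $R$ a relation on multi-distributions, $\mathbf m\,R^{\mathrm{obs}_{\mathrm{Nnf}}}\,\mathbf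 r$ means there is a maximal $R$-sequence $(\mathbf m_n)_n$ from $\mathbf m$ (infinite, or finite ending in an $R$-normal element and then continued constantly) with $\sup_n\mathrm{obs}_{\mathrm{Nnf}}(\mathbf m_n)=\mathbf r$; $\mathrm{Lim}_{\mathrm{obs}_{\mathrm{Nnf}}}(\mathbf m,R)$ is the set of such $\mathbf r$; $[\![\mathbf m]\!]$ is the greatest element of $\mathrm{Lim}_{\mathrm{obs}_{\mathrm{Nnf}}}(\mathbf m,\Rightarrow)$. A subrelation $R'\subseteq R$ is $\mathrm{obs}_{\mathrm{Nnf}}$-normalizing for $R$ if it is asymptotically complete ($\mathbf m R^{\mathrm{obs}}\mathbf q$ implies $\mathbf m R'^{\mathrm{obs}}\mathbf p$ for some $\mathbf p\ge\mathbf q$) and asymptotically uniform (every element of $\mathrm{Lim}(\mathbf m,R')$ is maximal in $\mathrm{Lim}(\mathbf m,R')$), for all $\mathbf m$. -}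

module Defs where

open import Level using (Level; 0ℓ; _⊔_) renaming (suc to lsuc)
open import Data.Fin.Base using (Fin)
open import Data.List.Base
  using (List; []; _∷_; map; foldr; filter; concat; tabulate; lookup; length)
open import Data.List.Properties using (filter-accept; filter-reject)
open import Data.List.Relation.Unary.All using (All; []; _∷_)
open import Data.List.Relation.Unary.AllPairs using ([]; _∷_)
open import Data.List.Relation.Unary.Unique.Propositional using (Unique)
import Data.List.Relation.Binary.Permutation.Setoid as Permutation
open import Data.Nat.Base using (ℕ; zero; suc)
import Data.Nat.Properties as ℕ
open import Data.Product using (_×_; _,_; proj₁; proj₂; ∃; ∃₂)
open import Data.Product.Relation.Binary.Pointwise.NonDependent using (×-setoid)
open import Data.Rational.Base as ℚ using (ℚ; 0ℚ; 1ℚ; ½)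
import Data.Rational.Properties as ℚ
open import Data.Rational.Solver using (module +-*-Solver)
open import Data.Sum.Base using (_⊎_; inj₁; inj₂)
open import Function.Base using (_∘_)
open import Relation.Binary.Bundles using (Setoid)
open import Relation.Binary.Core using (Rel) renaming (_⇒_ to _⊆_)
open import Relation.Binary.Definitions using (DecidableEquality)
open import Relation.Binary.PropositionalEquality
  using (_≡_; _≢_; refl; sym; cong; cong₂; subst; subst₂; setoid)
open import Relation.Nullary using (¬_; Dec; yes; no)
open import Relation.Nullary.Decidable using (map′; _×-dec_)
open import Relation.Unary using (Pred; _∈_; U)

1ℓ : Level
1ℓ = lsuc 0ℓ

------------------------------------------------------------------------
-- Non-negative reals

-- A non-negative (possibly infinite) real, presented by the set of
-- rationals strictly below it.  Classically these are exactly the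
-- elements of [0,∞].  Suprema of sequences exist constructively for
-- lower cuts, which is not the case for Cauchy or located reals.

record ℝ≥0 : Set₁ where
  field
    lower    : Pred ℚ 0ℓ
    closed   : ∀ {p q} → p ℚ.< q → lower q → lower p
    rounded  : ∀ {p} → lower p → ∃ λ q → p ℚ.< q × lower q
    negative : ∀ {p} → p ℚ.< 0ℚ → lower p

open ℝ≥0 public

infix 4 _≤_ _≈_

_≤_ : Rel ℝ≥0 0ℓ
x ≤ y = ∀ {q} → lower x q → lower y q

_≈_ : Rel ℝ≥0 0ℓ
x ≈ y = x ≤ y × y ≤ x

ℝ≥0-setoid : Setoid 1ℓ 0ℓ
ℝ≥0-setoid = record
  { Carrier       = ℝ≥0
  ; _≈_           = _≈_
  ; isEquivalence = record
    { refl  = (λ l → l) , (λ l → l)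
    ; sym   = λ (f , g) → g , f
    ; trans = λ (f , g) (h , k) → (λ l → h (f l)) , (λ l → g (k l))
    }
  }

Positive : Pred ℝ≥0 0ℓ
Positive x = lower x 0ℚ

fromℚ : (p : ℚ) → .{{ℚ.NonNegative p}} → ℝ≥0
fromℚ p = record
  { lower    = ℚ._< p
  ; closed   = ℚ.<-trans
  ; rounded  = λ q<p → let r , q<r , r<p = ℚ.<-dense q<p in r , q<r , r<p
  ; negative = λ q<0 → ℚ.<-≤-trans q<0 (ℚ.nonNegative⁻¹ p)
  }

0ℝ 1ℝ ½ℝ : ℝ≥0
0ℝ = fromℚ 0ℚ
1ℝ = fromℚ 1ℚ
½ℝ = fromℚ ½

private
  halves : ∀ p → ½ ℚ.* p ℚ.+ ½ ℚ.* p ≡ p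
  halves = solve 1 (λ p → con ½ :* p :+ con ½ :* p := p) refl
    where open +-*-Solver

  ½*-negative : ∀ {p} → p ℚ.< 0ℚ → ½ ℚ.* p ℚ.< 0ℚ
  ½*-negative p<0 = ℚ.*-monoʳ-<-pos ½ p<0

  cancel : ∀ p q → (p ℚ.- q) ℚ.+ q ≡ p
  cancel = solve 2 (λ p q → (p :- q) :+ q := p) refl
    where open +-*-Solver

  cancel′ : ∀ p q → (p ℚ.+ q) ℚ.- q ≡ p
  cancel′ = solve 2 (λ p q → (p :+ q) :- q := p) refl
    where open +-*-Solver

infixl 6 _+_
infixl 7 _*_

_+_ : ℝ≥0 → ℝ≥0 → ℝ≥0
x + y = record
  { lower    = λ q → ∃₂ λ s t → lower x s × lower y t × q ℚ.< s ℚ.+ t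
  ; closed   = λ p<q (s , t , s∈x , t∈y , q<st) →
                 s , t , s∈x , t∈y , ℚ.<-trans p<q q<st
  ; rounded  = λ (s , t , s∈x , t∈y , p<st) →
                 let r , p<r , r<st = ℚ.<-dense p<st
                 in r , p<r , (s , t , s∈x , t∈y , r<st)
  ; negative = λ {p} p<0 →
                 let r , p<r , r<0 = ℚ.<-dense p<0
                     h = ½*-negative r<0
                 in ½ ℚ.* r , ½ ℚ.* r , negative x h , negative y h
                    , subst (p ℚ.<_) (sym (halves r)) p<r
  }

_*_ : ℝ≥0 → ℝ≥0 → ℝ≥0
x * y = record
  { lower    = λ q → q ℚ.< 0ℚ ⊎ Below q
  ; closed   = λ where
      p<q (inj₁ q<0) → inj₁ (ℚ.<-trans p<q q<0)
      p<q (inj₂ (s , t , 0≤s , 0≤t , s∈x , t∈y , q<st)) →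
        inj₂ (s , t , 0≤s , 0≤t , s∈x , t∈y , ℚ.<-trans p<q q<st)
  ; rounded  = λ where
      (inj₁ p<0) → let r , p<r , r<0 = ℚ.<-dense p<0 in r , p<r , inj₁ r<0
      (inj₂ (s , t , 0≤s , 0≤t , s∈x , t∈y , p<st)) →
        let r , p<r , r<st = ℚ.<-dense p<st
        in r , p<r , inj₂ (s , t , 0≤s , 0≤t , s∈x , t∈y , r<st)
  ; negative = inj₁
  }
  where
  Below : Pred ℚ 0ℓ
  Below q = ∃₂ λ s t →
    0ℚ ℚ.≤ s × 0ℚ ℚ.≤ t × lower x s × lower y t × q ℚ.< s ℚ.* t

sum : List ℝ≥0 → ℝ≥0
sum = foldr _+_ 0ℝ

≤-reflexive : ∀ {x y} → x ≡ y → x ≤ y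
≤-reflexive refl l = l

+-mono-≤ : ∀ {x x′ y y′} → x ≤ x′ → y ≤ y′ → x + y ≤ x′ + y′
+-mono-≤ f g (s , t , s∈x , t∈y , q<st) = s , t , f s∈x , g t∈y , q<st

+-comm-≤ : ∀ x y → x + y ≤ y + x
+-comm-≤ x y {q} (s , t , s∈x , t∈y , q<st) =
  t , s , t∈y , s∈x , subst (q ℚ.<_) (ℚ.+-comm s t) q<st

+-identityˡ-≤ : ∀ x → 0ℝ + x ≤ x
+-identityˡ-≤ x {q} (s , t , s<0 , t∈x , q<st) = closed x q<t t∈x
  where
  q<t : q ℚ.< t
  q<t = ℚ.<-trans q<st (subst (s ℚ.+ t ℚ.<_) (ℚ.+-identityˡ t) (ℚ.+-monoˡ-< t s<0))

+-identityʳ-≤ : ∀ x → x + 0ℝ ≤ x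
+-identityʳ-≤ x l = +-identityˡ-≤ x (+-comm-≤ x 0ℝ l)

+-assoc-≤ : ∀ x y z → (x + y) + z ≤ x + (y + z)
+-assoc-≤ x y z {q} (u , c , (a , b , a∈x , b∈y , u<ab) , c∈z , q<uc) =
  let v , q-a<v , v<bc = ℚ.<-dense q-a<bc
  in a , v , a∈x , (b , c , b∈y , c∈z , v<bc)
     , subst₂ ℚ._<_ (cancel q a) (ℚ.+-comm v a) (ℚ.+-monoˡ-< a q-a<v)
  where
  rearrange : ∀ a b c → (a ℚ.+ b) ℚ.+ c ≡ (b ℚ.+ c) ℚ.+ a
  rearrange = solve 3 (λ a b c → (a :+ b) :+ c := (b :+ c) :+ a) refl
    where open +-*-Solver

  q<bca : q ℚ.< (b ℚ.+ c) ℚ.+ a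
  q<bca = subst (q ℚ.<_) (rearrange a b c) (ℚ.<-trans q<uc (ℚ.+-monoˡ-< c u<ab))

  q-a<bc : q ℚ.- a ℚ.< b ℚ.+ c
  q-a<bc = subst (q ℚ.- a ℚ.<_) (cancel′ (b ℚ.+ c) a) (ℚ.+-monoˡ-< (ℚ.- a) q<bca)

+-exchange-≤ : ∀ x y z → x + (y + z) ≤ y + (x + z)
+-exchange-≤ x y z l =
  +-mono-≤ {y} {y} {z + x} {x + z} (λ k → k) (+-comm-≤ z x)
    (+-assoc-≤ y z x (+-comm-≤ x (y + z) l))

------------------------------------------------------------------------
-- Terms

-- De Bruijn indices stand for α-equivalence classes of (possibly open)
-- named terms.

infix  5 ƛ_
infixl 6 _⊕_
infixl 7 _·_

data Term : Set where
  var : ℕ → Term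
  ƛ_  : Term → Term
  _·_ : Term → Term → Term
  _⊕_ : Term → Term → Term

infix 4 _≟_

_≟_ : DecidableEquality Term
var x   ≟ var y   = map′ (cong var) (λ { refl → refl }) (x ℕ.≟ y)
(ƛ M)   ≟ (ƛ N)   = map′ (cong ƛ_) (λ { refl → refl }) (M ≟ N)
(M · P) ≟ (N · Q) = map′ (λ (e , f) → cong₂ _·_ e f) (λ { refl → refl , refl })
                         ((M ≟ N) ×-dec (P ≟ Q))
(M ⊕ P) ≟ (N ⊕ Q) = map′ (λ (e , f) → cong₂ _⊕_ e f) (λ { refl → refl , refl })
                         ((M ≟ N) ×-dec (P ≟ Q))
var _   ≟ (ƛ _)   = no λ ()
var _   ≟ (_ · _) = no λ ()
var _   ≟ (_ ⊕ _) = no λ ()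
(ƛ _)   ≟ var _   = no λ ()
(ƛ _)   ≟ (_ · _) = no λ ()
(ƛ _)   ≟ (_ ⊕ _) = no λ ()
(_ · _) ≟ var _   = no λ ()
(_ · _) ≟ (ƛ _)   = no λ ()
(_ · _) ≟ (_ ⊕ _) = no λ ()
(_ ⊕ _) ≟ var _   = no λ ()
(_ ⊕ _) ≟ (ƛ _)   = no λ ()
(_ ⊕ _) ≟ (_ · _) = no λ ()

data Value : Pred Term 0ℓ where
  var : ∀ x → Value (var x)
  ƛ_  : ∀ M → Value (ƛ M)

ext : (ℕ → ℕ) → ℕ → ℕ
ext ρ zero    = zero
ext ρ (suc x) = suc (ρ x)

rename : (ℕ → ℕ) → Term → Term
rename ρ (var x) = var (ρ x)
rename ρ (ƛ M)   = ƛ rename (ext ρ) M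
rename ρ (M · N) = rename ρ M · rename ρ N
rename ρ (M ⊕ N) = rename ρ M ⊕ rename ρ N

exts : (ℕ → Term) → ℕ → Term
exts σ zero    = var zero
exts σ (suc x) = rename suc (σ x)

substitute : (ℕ → Term) → Term → Term
substitute σ (var x) = σ x
substitute σ (ƛ M)   = ƛ substitute (exts σ) M
substitute σ (M · N) = substitute σ M · substitute σ N
substitute σ (M ⊕ N) = substitute σ M ⊕ substitute σ N

infixl 8 _⟦_/0⟧

_⟦_/0⟧ : Term → Term → Term
M ⟦ V /0⟧ = substitute (λ { zero → V ; (suc x) → var x }) M

-- In the constructor names ∙ marks the side of the hole.

data Context : Set where
  □        : Context
  _·∙_     : Term → Context → Context
  _∙·_     : Context → Term → Context
  ƛ_       : Context → Context
  _∙⊕_     : Context → Term → Context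
  _⊕∙_     : Term → Context → Context

_⟨_⟩ : Context → Term → Term
□        ⟨ P ⟩ = P
(M ·∙ C) ⟨ P ⟩ = M · (C ⟨ P ⟩)
(C ∙· M) ⟨ P ⟩ = (C ⟨ P ⟩) · M
(ƛ C)    ⟨ P ⟩ = ƛ (C ⟨ P ⟩)
(C ∙⊕ M) ⟨ P ⟩ = (C ⟨ P ⟩) ⊕ M
(M ⊕∙ C) ⟨ P ⟩ = M ⊕ (C ⟨ P ⟩)

data WeakContext : Set where
  □    : WeakContext
  _∙·_ : WeakContext → Term → WeakContext
  _·∙_ : Term → WeakContext → WeakContext

_⟨_⟩ʷ : WeakContext → Term → Term
□        ⟨ P ⟩ʷ = P
(W ∙· M) ⟨ P ⟩ʷ = (W ⟨ P ⟩ʷ) · M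
(M ·∙ W) ⟨ P ⟩ʷ = M · (W ⟨ P ⟩ʷ)

------------------------------------------------------------------------
-- Multi-distributions

Weighted : Set₁
Weighted = List (ℝ≥0 × Term)

-- Lists of weighted terms up to _↭_ are finite multisets.
open Permutation (×-setoid ℝ≥0-setoid (setoid Term)) public using (_↭_)

total : Weighted → ℝ≥0
total = sum ∘ map proj₁

infixr 7 _⊙_

_⊙_ : ℝ≥0 → Weighted → Weighted
q ⊙ es = map (λ (p , M) → q * p , M) es

-- The bound p ≤ 1 on individual weights follows from total≤1.

record MDist : Set₁ where
  field
    entries  : Weighted
    positive : All (Positive ∘ proj₁) entries
    total≤1  : total entries ≤ 1ℝ

open MDist public

infix 4 _≋_

_≋_ : Rel MDist 1ℓ
m ≋ n = entries m ↭ entries n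

[_] : Term → MDist
[ M ] = record
  { entries  = (1ℝ , M) ∷ []
  ; positive = ℚ.positive⁻¹ 1ℚ ∷ []
  ; total≤1  = +-identityʳ-≤ 1ℝ
  }

[½_,½_] : Term → Term → MDist
[½ M ,½ N ] = record
  { entries  = (½ℝ , M) ∷ (½ℝ , N) ∷ []
  ; positive = ℚ.positive⁻¹ ½ ∷ ℚ.positive⁻¹ ½ ∷ []
  ; total≤1  = λ (s , t , s<½ , t∈ , q<st) →
      ℚ.<-trans q<st (ℚ.+-mono-< s<½ (+-identityʳ-≤ ½ℝ t∈))
  }

------------------------------------------------------------------------
-- Reductions

infix 4 _↦β_ _→β_ _→w_ _→⊕_ _⟶_ _⟶s_ _⇝U_ _⇝E_

data _↦β_ : Rel Term 0ℓ where
  βv : ∀ {M V} → Value V → (ƛ M) · V ↦β M ⟦ V /0⟧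

data _→β_ : Rel Term 0ℓ where
  close : ∀ C {P Q} → P ↦β Q → C ⟨ P ⟩ →β C ⟨ Q ⟩

data _→w_ : Rel Term 0ℓ where
  close : ∀ W {P Q} → P ↦β Q → W ⟨ P ⟩ʷ →w W ⟨ Q ⟩ʷ

data _→⊕_ : Term → MDist → Set₁ where
  choose : ∀ W {M N} → W ⟨ M ⊕ N ⟩ʷ →⊕ [½ W ⟨ M ⟩ʷ ,½ W ⟨ N ⟩ʷ ]

data _⟶_ : Term → MDist → Set₁ where
  byβ : ∀ {M N} → M →β N → M ⟶ [ N ]
  by⊕ : ∀ {M m} → M →⊕ m → M ⟶ m

data _⟶s_ : Term → MDist → Set₁ where
  byβ : ∀ {M N} → M →w N → M ⟶s [ N ]
  by⊕ : ∀ {M m} → M →⊕ m → M ⟶s m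

Normal : Pred Term 1ℓ
Normal M = ¬ ∃ λ m → M ⟶ m

SurfaceNormal : Pred Term 1ℓ
SurfaceNormal M = ¬ ∃ λ m → M ⟶s m

WeakNormal : Pred Term 0ℓ
WeakNormal M = ¬ ∃ λ N → M →w N

data _⇝U_ : Rel Term 0ℓ where
  weak : ∀ {M M′} → M →w M′ → M ⇝U M′
  lam  : ∀ {P P′} → WeakNormal (ƛ P) → P ⇝U P′ → ƛ P ⇝U ƛ P′
  appˡ : ∀ {P P′ Q} → WeakNormal (P · Q) → P ⇝U P′ → P · Q ⇝U P′ · Q
  appʳ : ∀ {P Q Q′} → WeakNormal (P · Q) → Q ⇝U Q′ → P · Q ⇝U P · Q′
  sumˡ : ∀ {P P′ Q} → WeakNormal (P ⊕ Q) → P ⇝U P′ → P ⊕ Q ⇝U P′ ⊕ Q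
  sumʳ : ∀ {P Q Q′} → WeakNormal (P ⊕ Q) → Q ⇝U Q′ → P ⊕ Q ⇝U P ⊕ Q′

data _⇝E_ : Term → MDist → Set₁ where
  surface : ∀ {M m} → ¬ SurfaceNormal M → M ⟶s m → M ⇝E m
  inner   : ∀ {M M′} → SurfaceNormal M → M ⇝U M′ → M ⇝E [ M′ ]

-- The lifting of r in which [ M ] may be kept unchanged only if M
-- satisfies Idle.  The rule resp makes the relation one on multisets.

data Lifting {ℓ} (Idle : Pred Term ℓ) (r : Term → MDist → Set₁) :
             MDist → MDist → Set (lsuc 0ℓ ⊔ ℓ) where
  idle : ∀ {M} → Idle M → Lifting Idle r [ M ] [ M ]
  step : ∀ {M m} → r M m → Lifting Idle r [ M ] m
  mix  : ∀ {m n} (ns : Fin (length (entries m)) → MDist) →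
         (∀ i → Lifting Idle r [ proj₂ (lookup (entries m) i) ] (ns i)) →
         entries n ↭ concat (tabulate λ i →
           proj₁ (lookup (entries m) i) ⊙ entries (ns i)) →
         Lifting Idle r m n
  resp : ∀ {m m′ n n′} → m ≋ m′ → n ≋ n′ →
         Lifting Idle r m n → Lifting Idle r m′ n′

infix 4 _⇒_ _⇛E_

_⇒_ : Rel MDist 1ℓ
_⇒_ = Lifting U _⟶_

_⇛E_ : Rel MDist 1ℓ
_⇛E_ = Lifting Normal _⇝E_

------------------------------------------------------------------------
-- Observations

-- Proofs of Normal M are definitionally equal, since ⊥ is proof
-- irrelevant, so this is a subset of Term.

Nnf : Set₁
Nnf = ∃ Normal

-- The sum over all of Nnf is bounded by 1 when all its finite
-- partial sums are.

record SubDist : Set₁ where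
  field
    mass   : Nnf → ℝ≥0
    mass≤1 : (Ns : List Nnf) → Unique (map proj₁ Ns) → sum (map mass Ns) ≤ 1ℝ

open SubDist public

infix 4 _⊑_ _≐_

_⊑_ : Rel SubDist 1ℓ
μ ⊑ ν = ∀ N → mass μ N ≤ mass ν N

_≐_ : Rel SubDist 1ℓ
μ ≐ ν = ∀ N → mass μ N ≈ mass ν N

massAt : Weighted → Term → ℝ≥0
massAt es N = total (filter (λ (p , M) → M ≟ N) es)

private
  Σmass : Weighted → List Nnf → ℝ≥0
  Σmass es Ns = sum (map (massAt es ∘ proj₁) Ns)

  massAt-≢ : ∀ {p M} es {N} → M ≢ N → massAt ((p , M) ∷ es) N ≡ massAt es N
  massAt-≢ es {N} M≢N = cong total (filter-reject (λ (_ , M) → M ≟ N) M≢N)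

  massAt-≡ : ∀ {p} es N → massAt ((p , N) ∷ es) N ≡ p + massAt es N
  massAt-≡ es N = cong total (filter-accept (λ (_ , M) → M ≟ N) refl)

  Σmass-∉ : ∀ {p M} es Ns → All (M ≢_) (map proj₁ Ns) →
            Σmass ((p , M) ∷ es) Ns ≡ Σmass es Ns
  Σmass-∉ es []       []             = refl
  Σmass-∉ es (N ∷ Ns) (M≢N ∷ M∉Ns) =
    cong₂ _+_ (massAt-≢ es M≢N) (Σmass-∉ es Ns M∉Ns)

  Σmass-∷ : ∀ p M es Ns → Unique (map proj₁ Ns) →
            Σmass ((p , M) ∷ es) Ns ≤ p + Σmass es Ns
  Σmass-∷ p M es [] _ q<0 = negative (p + 0ℝ) q<0
  Σmass-∷ p M es (N ∷ Ns) (N∉Ns ∷ u) = split (M ≟ proj₁ N)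
    where
    split : Dec (M ≡ proj₁ N) →
            Σmass ((p , M) ∷ es) (N ∷ Ns) ≤ p + Σmass es (N ∷ Ns)
    split (yes refl) l =
      +-assoc-≤ p (massAt es M) (Σmass es Ns)
        (≤-reflexive (cong₂ _+_ (massAt-≡ es M) (Σmass-∉ es Ns N∉Ns)) l)
    split (no M≢N) l =
      +-exchange-≤ (massAt es (proj₁ N)) p (Σmass es Ns)
        (+-mono-≤ {massAt ((p , M) ∷ es) (proj₁ N)} {massAt es (proj₁ N)}
                  {Σmass ((p , M) ∷ es) Ns} {p + Σmass es Ns}
                  (≤-reflexive (massAt-≢ es M≢N)) (Σmass-∷ p M es Ns u) l)

  Σmass≤total : ∀ es Ns → Unique (map proj₁ Ns) → Σmass es Ns ≤ total es
  Σmass≤total []             []       u       l = l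
  Σmass≤total []             (N ∷ Ns) (_ ∷ u) l =
    Σmass≤total [] Ns u (+-identityˡ-≤ (Σmass [] Ns) l)
  Σmass≤total ((p , M) ∷ es) Ns       u       l =
    +-mono-≤ {p} {p} {Σmass es Ns} {total es} (λ k → k) (Σmass≤total es Ns u)
      (Σmass-∷ p M es Ns u l)

obs : MDist → SubDist
obs m = record
  { mass   = λ (N , _) → massAt (entries m) N
  ; mass≤1 = λ Ns u l → total≤1 m (Σmass≤total (entries m) Ns u l)
  }

------------------------------------------------------------------------
-- Asymptotic behaviour

IsSup : (ℕ → SubDist) → Pred SubDist 1ℓ
IsSup μs ρ = (∀ n → μs n ⊑ ρ) × (∀ ν → (∀ n → μs n ⊑ ν) → ρ ⊑ ν)

-- The two alternatives of step exclude each other, so a maximal sequence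
-- either goes on forever, or stops at the first R-normal element and is
-- constant from there.  Which of the two happens need not be decidable.

record MaximalSequence (R : Rel MDist 1ℓ) (m : MDist) (s : ℕ → MDist) : Set₁ where
  field
    start : s 0 ≋ m
    next  : ∀ n → R (s n) (s (suc n))
                ⊎ ((¬ ∃ λ n′ → R (s n) n′) × s n ≋ s (suc n))

-- ρ ∈ Lim m R is the relation m R^obs ρ.

Lim : MDist → Rel MDist 1ℓ → Pred SubDist 1ℓ
Lim m R ρ = ∃ λ s → MaximalSequence R m s × IsSup (obs ∘ s) ρ

IsGreatest : Pred SubDist 1ℓ → Pred SubDist 1ℓ
IsGreatest S μ = μ ∈ S × (∀ ν → ν ∈ S → ν ⊑ μ)

IsMaximal : Pred SubDist 1ℓ → Pred SubDist 1ℓ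
IsMaximal S μ = μ ∈ S × (∀ ν → ν ∈ S → μ ⊑ ν → ν ≐ μ)

AsymptoticallyComplete : Rel MDist 1ℓ → Rel MDist 1ℓ → Set₁
AsymptoticallyComplete R′ R =
  ∀ m μ → μ ∈ Lim m R → ∃ λ ν → ν ∈ Lim m R′ × μ ⊑ ν

AsymptoticallyUniform : Rel MDist 1ℓ → Set₁
AsymptoticallyUniform R′ = ∀ m μ → μ ∈ Lim m R′ → IsMaximal (Lim m R′) μ

Normalizing : Rel MDist 1ℓ → Rel MDist 1ℓ → Set₁
Normalizing R′ R =
  (R′ ⊆ R) × AsymptoticallyComplete R′ R × AsymptoticallyUniform R′

{-# OPTIONS --safe #-}
module Submission where

-- Everything follows from one comparison: if m ⇒ … ⇒ n, then every
-- ⇛E-sequence from m eventually gives each normal form N at least the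
-- probability that n gives it.
--
-- Let "M reaches N within k steps with probability ≥ x" refer to an
-- evaluation tree of ⇝E-steps.  Two ⇝E-steps from the same term close in
-- exactly one step on every branch, so this probability does not depend
-- on the choice of steps (random descent); hence it is inherited by any
-- ⇛E-sequence.  Conversely, it is pulled back along an arbitrary β-step,
-- or more generally a parallel step M ∥ M′: factor it into weak steps
-- followed by an internal parallel step, which preserves and reflects
-- the redexes in weak position and so commutes with the surface steps of
-- M′.  When M′ is surface normal only β remains, and the same
-- factorization shows that the big-step form of ⇝U is closed under
-- ∥-expansion.

open import Defs
open import Data.Fin.Base using (Fin; zero; suc)
open import Data.List.Base
  using ([]; _∷_; _++_; map; concat; tabulate; lookup; length)
open import Data.List.Relation.Binary.Pointwise.Base using ([]; _∷_)
open import Data.List.Relation.Unary.All using (All; []; _∷_)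
import Data.List.Relation.Unary.All.Properties as All
open import Data.Nat.Base as ℕ using (ℕ; zero; suc; z≤n; s≤s; _≤′_; ≤′-refl; ≤′-step)
import Data.Nat.Properties as ℕ
open import Data.Product using (_×_; _,_; proj₁; proj₂; ∃; ∃₂; map₂)
open import Data.Product.Relation.Binary.Pointwise.NonDependent using (×-setoid)
open import Data.Rational.Base as ℚ using (ℚ; 0ℚ)
import Data.Rational.Properties as ℚ
open import Data.Sum.Base using (_⊎_; inj₁; inj₂; [_,_]′)
open import Data.Unit.Base using (tt)
open import Function.Base using (_∘_)
open import Function.Bundles using (_⇔_; mk⇔)
open import Level using (0ℓ)
open import Relation.Binary.Construct.Closure.ReflexiveTransitive
  using (Star; ε; _◅_; _◅◅_; gmap)
open import Relation.Binary.Core using (Rel) renaming (_⇒_ to _⊆_)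
open import Relation.Binary.PropositionalEquality
  using (_≡_; refl; sym; trans; cong; cong₂; subst; setoid)
open import Relation.Nullary using (¬_; Dec; yes; no; contradiction)
open import Relation.Unary using (Pred; _∈_)

import Data.List.Relation.Binary.Permutation.Homogeneous as Permutation
open import Data.List.Relation.Binary.Permutation.Setoid
  (×-setoid ℝ≥0-setoid (setoid Term)) using (↭-refl; ↭-sym)

-- Sums and products of cuts

infix  4 _≼_
infixr 9 _⨾_

-- Unlike _≤_, which unfolds to a function type, this record lets Agda
-- infer the two cuts.
record _≼_ (x y : ℝ≥0) : Set where
  constructor up
  field to-≤ : x ≤ y

open _≼_

≼-refl : ∀ {x} → x ≼ x
≼-refl = up λ l → l

_⨾_ : ∀ {x y z} → x ≼ y → y ≼ z → x ≼ z
up f ⨾ up g = up λ l → g (f l)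

-‿< : ∀ {p q r} → p ℚ.< q ℚ.+ r → p ℚ.- r ℚ.< q
-‿< {p} {q} {r} p<q+r = subst (p ℚ.- r ℚ.<_) eq (ℚ.+-monoˡ-< (ℚ.- r) p<q+r)
  where
  eq : (q ℚ.+ r) ℚ.- r ≡ q
  eq rewrite ℚ.+-assoc q r (ℚ.- r) | ℚ.+-inverseʳ r = ℚ.+-identityʳ q

<-+ : ∀ {p q r} → p ℚ.- r ℚ.< q → p ℚ.< q ℚ.+ r
<-+ {p} {q} {r} p-r<q = subst (ℚ._< q ℚ.+ r) eq (ℚ.+-monoˡ-< r p-r<q)
  where
  eq : (p ℚ.- r) ℚ.+ r ≡ p
  eq rewrite ℚ.+-assoc p (ℚ.- r) r | ℚ.+-inverseˡ r = ℚ.+-identityʳ p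

-- Density applies twice: `v` lies between `q - d` and `c`, then `w` between `q - v` and `d`. It
-- supplies the witnesses that membership in a sum of cuts asks for.
+-dense : ∀ {q c d} → q ℚ.< c ℚ.+ d →
          ∃₂ λ v w → v ℚ.< c × w ℚ.< d × q ℚ.< v ℚ.+ w
+-dense {q} {c} {d} q<c+d =
  let v , q-d<v , v<c = ℚ.<-dense (-‿< {q} {c} {d} q<c+d)
      q-v<d = -‿< {q} {d} {v}
                (subst (q ℚ.<_) (ℚ.+-comm v d) (<-+ {q} {v} {d} q-d<v))
      w , q-v<w , w<d = ℚ.<-dense q-v<d
  in v , w , v<c , w<d
   , subst (q ℚ.<_) (ℚ.+-comm w v) (<-+ {q} {w} {v} q-v<w)

infixl 6 _⊹_
infixl 7 _⊛_

-- The operations of Defs unfold to records, and so are not injective for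
-- unification; these opaque copies are.
opaque
  _⊹_ _⊛_ : ℝ≥0 → ℝ≥0 → ℝ≥0
  x ⊹ y = x + y
  x ⊛ y = x * y

opaque
  unfolding _⊹_ _⊛_

  ⊹-mono-< : ∀ {x y s t} → lower x s → lower y t → lower (x ⊹ y) (s ℚ.+ t)
  ⊹-mono-< {x} s∈x t∈y =
    let s′ , s<s′ , s′∈x = rounded x s∈x
    in s′ , _ , s′∈x , t∈y , ℚ.+-monoˡ-< _ s<s′

  ⊛-mono-< : ∀ {x y s t} → 0ℚ ℚ.≤ s → 0ℚ ℚ.≤ t →
             lower x s → lower y t → lower (x ⊛ y) (s ℚ.* t)
  ⊛-mono-< {x} {y} {s} {t} 0≤s 0≤t s∈x t∈y =
    let s′ , s<s′ , s′∈x = rounded x s∈x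
        t′ , t<t′ , t′∈y = rounded y t∈y
        0<s′ = ℚ.≤-<-trans 0≤s s<s′
    in inj₂ (s′ , t′ , ℚ.<⇒≤ 0<s′ , ℚ.<⇒≤ (ℚ.≤-<-trans 0≤t t<t′) , s′∈x , t′∈y
      , ℚ.≤-<-trans
          (ℚ.*-monoʳ-≤-nonNeg t {{ℚ.nonNegative 0≤t}} (ℚ.<⇒≤ s<s′))
          (ℚ.*-monoʳ-<-pos s′ {{ℚ.positive 0<s′}} t<t′))

  -- Unlike in the definition of _*_, t may be negative.
  ⊛-below : ∀ {x y s t q} → 0ℚ ℚ.≤ s → lower x s → lower y t →
            q ℚ.< s ℚ.* t → lower (x ⊛ y) q
  ⊛-below {x} {y} {s} {t} 0≤s s∈x t∈y q<st with 0ℚ ℚ.≤? t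
  ... | yes 0≤t = inj₂ (s , t , 0≤s , 0≤t , s∈x , t∈y , q<st)
  ... | no  0≰t = inj₁ (ℚ.<-≤-trans q<st st≤0)
    where
    st≤0 : s ℚ.* t ℚ.≤ 0ℚ
    st≤0 = subst (s ℚ.* t ℚ.≤_) (ℚ.*-zeroʳ s)
      (ℚ.*-monoˡ-≤-nonNeg s {{ℚ.nonNegative 0≤s}} (ℚ.<⇒≤ (ℚ.≰⇒> 0≰t)))

  ⊹-mono : ∀ {x x′ y y′} → x ≼ x′ → y ≼ y′ → x ⊹ y ≼ x′ ⊹ y′
  ⊹-mono {x} {x′} {y} {y′} (up f) (up g) = up (+-mono-≤ {x} {x′} {y} {y′} f g)

  ⊹-comm : ∀ x y → x ⊹ y ≼ y ⊹ x
  ⊹-comm x y = up (+-comm-≤ x y)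

  ⊹-assoc : ∀ x y z → (x ⊹ y) ⊹ z ≼ x ⊹ (y ⊹ z)
  ⊹-assoc x y z = up (+-assoc-≤ x y z)

  ⊹-assoc˘ : ∀ x y z → x ⊹ (y ⊹ z) ≼ (x ⊹ y) ⊹ z
  ⊹-assoc˘ x y z =
    ⊹-comm x (y ⊹ z) ⨾ ⊹-assoc y z x ⨾ ⊹-comm y (z ⊹ x) ⨾ ⊹-assoc z x y ⨾ ⊹-comm z (x ⊹ y)

  ⊹-identityˡ : ∀ x → 0ℝ ⊹ x ≼ x
  ⊹-identityˡ x = up (+-identityˡ-≤ x)

  ⊹-identityʳ : ∀ x → x ⊹ 0ℝ ≼ x
  ⊹-identityʳ x = up (+-identityʳ-≤ x)

  0≼ : ∀ x → 0ℝ ≼ x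
  0≼ x = up (negative x)

  -- Every cut contains the negative rationals, so `x` contributes a `v` just below 0; roundedness
  -- of `y` makes room for it.
  y≼x⊹y : ∀ x y → y ≼ x ⊹ y
  y≼x⊹y x y = up λ {q} q∈y →
    let t , q<t , t∈y = rounded y q∈y
        v , w , v<0 , w<t , q<v+w = +-dense (subst (q ℚ.<_) (sym (ℚ.+-identityˡ t)) q<t)
    in v , w , negative x v<0 , closed y w<t t∈y , q<v+w

  x≼x⊹y : ∀ x y → x ≼ x ⊹ y
  x≼x⊹y x y = y≼x⊹y y x ⨾ ⊹-comm y x

  ⊛-mono : ∀ {x x′ y y′} → x ≼ x′ → y ≼ y′ → x ⊛ y ≼ x′ ⊛ y′
  ⊛-mono (up f) (up g) = up λ where
    (inj₁ q<0) → inj₁ q<0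
    (inj₂ (s , t , 0≤s , 0≤t , s∈x , t∈y , q<st)) →
      inj₂ (s , t , 0≤s , 0≤t , f s∈x , g t∈y , q<st)

  ⊛-monoʳ : ∀ x {y y′} → y ≼ y′ → x ⊛ y ≼ x ⊛ y′
  ⊛-monoʳ x = ⊛-mono (≼-refl {x})

  ⊛-comm : ∀ x y → x ⊛ y ≼ y ⊛ x
  ⊛-comm x y = up λ where
    (inj₁ q<0) → inj₁ q<0
    {q} (inj₂ (s , t , 0≤s , 0≤t , s∈x , t∈y , q<st)) →
      inj₂ (t , s , 0≤t , 0≤s , t∈y , s∈x , subst (q ℚ.<_) (ℚ.*-comm s t) q<st)

  *-nonNeg : ∀ {s t} → 0ℚ ℚ.≤ s → 0ℚ ℚ.≤ t → 0ℚ ℚ.≤ s ℚ.* t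
  *-nonNeg {s} {t} 0≤s 0≤t = ℚ.nonNegative⁻¹ (s ℚ.* t)
    {{ℚ.nonNeg*nonNeg⇒nonNeg s {{ℚ.nonNegative 0≤s}} t {{ℚ.nonNegative 0≤t}}}}

  ⊛-assoc˘ : ∀ x y z → x ⊛ (y ⊛ z) ≼ (x ⊛ y) ⊛ z
  ⊛-assoc˘ x y z = up λ where
    (inj₁ q<0) → inj₁ q<0
    (inj₂ (s , u , 0≤s , 0≤u , s∈x , inj₁ u<0 , q<su)) →
      contradiction refl (ℚ.<⇒≢ (ℚ.≤-<-trans 0≤u u<0))
    {q} (inj₂ (s , u , 0≤s , 0≤u , s∈x
        , inj₂ (t , w , 0≤t , 0≤w , t∈y , w∈z , u<tw) , q<su)) →
      inj₂ (s ℚ.* t , w , *-nonNeg 0≤s 0≤t , 0≤w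
        , ⊛-mono-< {x} {y} 0≤s 0≤t s∈x t∈y , w∈z
        , ℚ.<-≤-trans q<su (subst (s ℚ.* u ℚ.≤_) (sym (ℚ.*-assoc s t w))
            (ℚ.*-monoˡ-≤-nonNeg s {{ℚ.nonNegative 0≤s}} (ℚ.<⇒≤ u<tw))))

  ⊛-assoc : ∀ x y z → (x ⊛ y) ⊛ z ≼ x ⊛ (y ⊛ z)
  ⊛-assoc x y z =
    ⊛-comm (x ⊛ y) z ⨾ ⊛-monoʳ z (⊛-comm x y) ⨾ ⊛-assoc˘ z y x
    ⨾ ⊛-comm (z ⊛ y) x ⨾ ⊛-monoʳ x (⊛-comm z y)

  ⊛-zeroʳ : ∀ x → x ⊛ 0ℝ ≼ 0ℝ
  ⊛-zeroʳ x = up λ where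
    (inj₁ q<0) → q<0
    (inj₂ (s , t , 0≤s , 0≤t , s∈x , t<0 , q<st)) → contradiction refl (ℚ.<⇒≢ (ℚ.≤-<-trans 0≤t t<0))

  ⊛-identityˡ : ∀ x → 1ℝ ⊛ x ≼ x
  ⊛-identityˡ x = up λ where
    (inj₁ q<0) → negative x q<0
    (inj₂ (s , t , 0≤s , 0≤t , s<1 , t∈x , q<st)) →
      closed x (ℚ.<-≤-trans q<st (subst (s ℚ.* t ℚ.≤_) (ℚ.*-identityˡ t)
        (ℚ.*-monoʳ-≤-nonNeg t {{ℚ.nonNegative 0≤t}} (ℚ.<⇒≤ s<1)))) t∈x

  -- For nonnegative `q`, roundedness gives a larger `t` in `x`; then `q / t` is below 1, and any
  -- `s` strictly between them satisfies `q < s * t`.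
  ⊛-identityˡ˘ : ∀ x → x ≼ 1ℝ ⊛ x
  ⊛-identityˡ˘ x = up λ {q} → below q
    where
    below : ∀ q → lower x q → lower (1ℝ ⊛ x) q
    below q q∈x with 0ℚ ℚ.≤? q
    ... | no  0≰q = inj₁ (ℚ.≰⇒> 0≰q)
    ... | yes 0≤q =
      let t , q<t , t∈x = rounded x q∈x
          0<t = ℚ.≤-<-trans 0≤q q<t
          instance
            t>0 = ℚ.positive 0<t
            t≢0 = ℚ.pos⇒nonZero t
            1/t>0 = ℚ.1/pos⇒pos t
          q/t = q ℚ.* (ℚ.1/ t)
          q/t<1 = subst (q/t ℚ.<_) (ℚ.*-inverseʳ t) (ℚ.*-monoˡ-<-pos (ℚ.1/ t) q<t)
          s , q/t<s , s<1 = ℚ.<-dense q/t<1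
          0≤s = ℚ.≤-trans (*-nonNeg 0≤q (ℚ.<⇒≤ (ℚ.positive⁻¹ (ℚ.1/ t)))) (ℚ.<⇒≤ q/t<s)
      in inj₂ (s , t , 0≤s , ℚ.<⇒≤ 0<t , s<1 , t∈x
        , subst (ℚ._< s ℚ.* t) (div t) (ℚ.*-monoˡ-<-pos t q/t<s))
      where
      div : ∀ t .{{_ : ℚ.NonZero t}} → q ℚ.* (ℚ.1/ t) ℚ.* t ≡ q
      div t = trans (ℚ.*-assoc q (ℚ.1/ t) t)
        (trans (cong (q ℚ.*_) (ℚ.*-inverseˡ t)) (ℚ.*-identityʳ q))

  ⊛-identityʳ : ∀ x → x ⊛ 1ℝ ≼ x
  ⊛-identityʳ x = ⊛-comm x 1ℝ ⨾ ⊛-identityˡ x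

  ⊛-identityʳ˘ : ∀ x → x ≼ x ⊛ 1ℝ
  ⊛-identityʳ˘ x = ⊛-identityˡ˘ x ⨾ ⊛-comm 1ℝ x

  ⊛-distribˡ : ∀ x y z → x ⊛ (y ⊹ z) ≼ x ⊛ y ⊹ x ⊛ z
  ⊛-distribˡ x y z = up λ where
    (inj₁ q<0) → negative (x ⊛ y ⊹ x ⊛ z) q<0
    {q} (inj₂ (s , u , 0≤s , 0≤u , s∈x , (a , b , a∈y , b∈z , u<a+b) , q<su)) →
      let su≤ = ℚ.*-monoˡ-≤-nonNeg s {{ℚ.nonNegative 0≤s}} (ℚ.<⇒≤ u<a+b)
          q<sa+sb = subst (q ℚ.<_) (ℚ.*-distribˡ-+ s a b) (ℚ.<-≤-trans q<su su≤)
          v , w , v<sa , w<sb , q<v+w = +-dense q<sa+sb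
      in v , w , ⊛-below {x} {y} 0≤s s∈x a∈y v<sa , ⊛-below {x} {z} 0≤s s∈x b∈z w<sb
       , q<v+w

  -- The two products come with different factors `s` and `t` below `x`. Their maximum is one of
  -- them, hence still below `x`, and serves for both. A negative summand is dropped instead.
  ⊛-distribˡ˘ : ∀ x y z → x ⊛ y ⊹ x ⊛ z ≼ x ⊛ (y ⊹ z)
  ⊛-distribˡ˘ x y z = up below
    where
    drop : ∀ {q v w} → q ℚ.< v ℚ.+ w → v ℚ.< 0ℚ → q ℚ.< w
    drop {q} {v} {w} q<v+w v<0 = ℚ.<-trans q<v+w
      (subst (v ℚ.+ w ℚ.<_) (ℚ.+-identityˡ w) (ℚ.+-monoˡ-< w v<0))

    below : x ⊛ y ⊹ x ⊛ z ≤ x ⊛ (y ⊹ z)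
    below (v , w , inj₁ v<0 , w∈xz , q<v+w) =
      to-≤ (⊛-monoʳ x (y≼x⊹y y z)) (closed (x ⊛ z) (drop q<v+w v<0) w∈xz)
    below {q} (v , w , v∈xy@(inj₂ _) , inj₁ w<0 , q<v+w) =
      to-≤ (⊛-monoʳ x (x≼x⊹y y z))
        (closed (x ⊛ y) (drop (subst (q ℚ.<_) (ℚ.+-comm v w) q<v+w) w<0) v∈xy)
    below (v , w , inj₂ (s , a , 0≤s , 0≤a , s∈x , a∈y , v<sa)
                 , inj₂ (t , b , 0≤t , 0≤b , t∈x , b∈z , w<tb) , q<v+w) =
      let m = s ℚ.⊔ t
          0≤m = ℚ.≤-trans 0≤s (ℚ.p≤p⊔q s t)
          sa≤ma = ℚ.*-monoʳ-≤-nonNeg a {{ℚ.nonNegative 0≤a}} (ℚ.p≤p⊔q s t)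
          tb≤mb = ℚ.*-monoʳ-≤-nonNeg b {{ℚ.nonNegative 0≤b}} (ℚ.p≤q⊔p s t)
          m∈x = [ (λ e → subst (lower x) (sym e) s∈x)
                , (λ e → subst (lower x) (sym e) t∈x) ]′ (ℚ.⊔-sel s t)
          v+w<ma+mb = ℚ.+-mono-< (ℚ.<-≤-trans v<sa sa≤ma) (ℚ.<-≤-trans w<tb tb≤mb)
      in closed (x ⊛ (y ⊹ z))
           (ℚ.<-trans q<v+w (subst (v ℚ.+ w ℚ.<_) (sym (ℚ.*-distribˡ-+ m a b)) v+w<ma+mb))
           (⊛-mono-< {x} {y ⊹ z} 0≤m (ℚ.+-mono-≤ 0≤a 0≤b) m∈x
             (⊹-mono-< {y} {z} a∈y b∈z))

  *-positive : ∀ {x y} → Positive x → Positive y → Positive (x * y)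
  *-positive {x} {y} = ⊛-mono-< {x} {y} ℚ.≤-refl ℚ.≤-refl

  -- The weights in `_⊙_` and `total` are built with the transparent operations; these mixed laws
  -- pass between them and the opaque ones.
  *-⊛-assoc : ∀ x y z → (x * y) ⊛ z ≼ x ⊛ (y ⊛ z)
  *-⊛-assoc = ⊛-assoc

  *-⊛-assoc˘ : ∀ x y z → x ⊛ (y ⊛ z) ≼ (x * y) ⊛ z
  *-⊛-assoc˘ = ⊛-assoc˘

  ⊹-exchange : ∀ x y z → x ⊹ (y ⊹ z) ≼ y ⊹ (x ⊹ z)
  ⊹-exchange x y z = up (+-exchange-≤ x y z)

  +≼⊹ : ∀ x y → x + y ≼ x ⊹ y
  +≼⊹ x y = ≼-refl

  ⊹≼+ : ∀ x y → x ⊹ y ≼ x + y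
  ⊹≼+ x y = ≼-refl

  *≼⊛ : ∀ x y → x * y ≼ x ⊛ y
  *≼⊛ x y = ≼-refl

-- Substitution

private
  variable
    ρ ξ χ : ℕ → ℕ
    σ τ υ : ℕ → Term
    A B C D L M M′ N P P′ Q V V′ : Term

-- Here and in the laws below, the composite is specified pointwise, so going under a binder needs
-- no function extensionality.
ext-∘ : (∀ x → ρ (ξ x) ≡ χ x) → ∀ x → ext ρ (ext ξ x) ≡ ext χ x
ext-∘ h zero    = refl
ext-∘ h (suc x) = cong suc (h x)

rename-rename : (∀ x → ρ (ξ x) ≡ χ x) → ∀ M → rename ρ (rename ξ M) ≡ rename χ M
rename-rename h (var x) = cong var (h x)
rename-rename h (ƛ M)   = cong ƛ_ (rename-rename (ext-∘ h) M)
rename-rename h (M · N) = cong₂ _·_ (rename-rename h M) (rename-rename h N)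
rename-rename h (M ⊕ N) = cong₂ _⊕_ (rename-rename h M) (rename-rename h N)

exts-ext : (∀ x → σ (ρ x) ≡ τ x) → ∀ x → exts σ (ext ρ x) ≡ exts τ x
exts-ext h zero    = refl
exts-ext h (suc x) = cong (rename suc) (h x)

substitute-rename : (∀ x → σ (ρ x) ≡ τ x) →
                    ∀ M → substitute σ (rename ρ M) ≡ substitute τ M
substitute-rename h (var x) = h x
substitute-rename h (ƛ M)   = cong ƛ_ (substitute-rename (exts-ext h) M)
substitute-rename h (M · N) = cong₂ _·_ (substitute-rename h M) (substitute-rename h N)
substitute-rename h (M ⊕ N) = cong₂ _⊕_ (substitute-rename h M) (substitute-rename h N)

rename-ext-suc : ∀ M → rename (ext ρ) (rename suc M) ≡ rename suc (rename ρ M)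
rename-ext-suc M =
  trans (rename-rename (λ _ → refl) M) (sym (rename-rename (λ _ → refl) M))

rename-exts : (∀ x → rename ρ (σ x) ≡ τ x) →
              ∀ x → rename (ext ρ) (exts σ x) ≡ exts τ x
rename-exts         h zero    = refl
rename-exts {σ = σ} h (suc x) =
  trans (rename-ext-suc (σ x)) (cong (rename suc) (h x))

rename-substitute : (∀ x → rename ρ (σ x) ≡ τ x) →
                    ∀ M → rename ρ (substitute σ M) ≡ substitute τ M
rename-substitute h (var x) = h x
rename-substitute h (ƛ M)   = cong ƛ_ (rename-substitute (rename-exts h) M)
rename-substitute h (M · N) = cong₂ _·_ (rename-substitute h M) (rename-substitute h N)
rename-substitute h (M ⊕ N) = cong₂ _⊕_ (rename-substitute h M) (rename-substitute h N)

substitute-exts-suc : ∀ M →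
  substitute (exts σ) (rename suc M) ≡ rename suc (substitute σ M)
substitute-exts-suc M =
  trans (substitute-rename (λ _ → refl) M) (sym (rename-substitute (λ _ → refl) M))

substitute-exts : (∀ x → substitute σ (τ x) ≡ υ x) →
                  ∀ x → substitute (exts σ) (exts τ x) ≡ exts υ x
substitute-exts         h zero    = refl
substitute-exts {τ = τ} h (suc x) =
  trans (substitute-exts-suc (τ x)) (cong (rename suc) (h x))

substitute-substitute : (∀ x → substitute σ (τ x) ≡ υ x) →
                        ∀ M → substitute σ (substitute τ M) ≡ substitute υ M
substitute-substitute h (var x) = h x
substitute-substitute h (ƛ M)   = cong ƛ_ (substitute-substitute (substitute-exts h) M)
substitute-substitute h (M · N) =
  cong₂ _·_ (substitute-substitute h M) (substitute-substitute h N)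
substitute-substitute h (M ⊕ N) =
  cong₂ _⊕_ (substitute-substitute h M) (substitute-substitute h N)

exts-var : (∀ x → σ x ≡ var x) → ∀ x → exts σ x ≡ var x
exts-var h zero    = refl
exts-var h (suc x) = cong (rename suc) (h x)

substitute-var : (∀ x → σ x ≡ var x) → ∀ M → substitute σ M ≡ M
substitute-var h (var x) = h x
substitute-var h (ƛ M)   = cong ƛ_ (substitute-var (exts-var h) M)
substitute-var h (M · N) = cong₂ _·_ (substitute-var h M) (substitute-var h N)
substitute-var h (M ⊕ N) = cong₂ _⊕_ (substitute-var h M) (substitute-var h N)

rename-⟦/0⟧ : ∀ ρ M V → rename ρ (M ⟦ V /0⟧) ≡ rename (ext ρ) M ⟦ rename ρ V /0⟧
rename-⟦/0⟧ ρ M V = trans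
  (rename-substitute {τ = κ} (λ { zero → refl ; (suc _) → refl }) M)
  (sym (substitute-rename (λ { zero → refl ; (suc _) → refl }) M))
  where
  κ : ℕ → Term
  κ zero    = rename ρ V
  κ (suc x) = var (ρ x)

-- Both sides equal the single simultaneous substitution `κ`; on the right, substituting for index 0
-- undoes the weakening made by `exts`.
substitute-⟦/0⟧ : ∀ σ M V →
  substitute σ (M ⟦ V /0⟧) ≡ substitute (exts σ) M ⟦ substitute σ V /0⟧
substitute-⟦/0⟧ σ M V = trans
  (substitute-substitute {υ = κ} (λ { zero → refl ; (suc _) → refl }) M)
  (sym (substitute-substitute
    (λ { zero → refl
       ; (suc x) → trans (substitute-rename (λ _ → refl) (σ x))
                         (substitute-var (λ _ → refl) (σ x)) })
    M))
  where
  κ : ℕ → Term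
  κ zero    = substitute σ V
  κ (suc x) = σ x

rename-value : Value V → Value (rename ρ V)
rename-value (var x) = var _
rename-value (ƛ M)   = ƛ _

Values : (ℕ → Term) → Set
Values σ = ∀ x → Value (σ x)

substitute-value : Values σ → Value V → Value (substitute σ V)
substitute-value vs (var x) = vs x
substitute-value vs (ƛ M)   = ƛ _

exts-values : Values σ → Values (exts σ)
exts-values vs zero    = var 0
exts-values vs (suc x) = rename-value (vs x)

-- Surface reduction

infix 4 _⇀_ _⇉_

-- Inductive forms of `_→w_` and `_→⊕_`: without contexts in the indices, steps can be analysed by
-- pattern matching.
data _⇀_ : Rel Term 0ℓ where
  root : Value V → (ƛ M) · V ⇀ M ⟦ V /0⟧
  appˡ : M ⇀ M′ → M · N ⇀ M′ · N
  appʳ : M ⇀ M′ → N · M ⇀ N · M′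

data _⇉_ : Term → Term × Term → Set where
  root : A ⊕ B ⇉ (A , B)
  appˡ : M ⇉ (A , B) → M · N ⇉ (A · N , B · N)
  appʳ : M ⇉ (A , B) → N · M ⇉ (N · A , N · B)

⇀⇒→w : M ⇀ N → M →w N
⇀⇒→w (root v) = close □ (βv v)
⇀⇒→w (appˡ r) with close W b ← ⇀⇒→w r = close (W ∙· _) b
⇀⇒→w (appʳ r) with close W b ← ⇀⇒→w r = close (_ ·∙ W) b

→w⇒⇀ : M →w N → M ⇀ N
→w⇒⇀ (close W b) = plug W b
  where
  plug : ∀ W → P ↦β Q → W ⟨ P ⟩ʷ ⇀ W ⟨ Q ⟩ʷ
  plug □        (βv v) = root v
  plug (W ∙· _) b      = appˡ (plug W b)
  plug (_ ·∙ W) b      = appʳ (plug W b)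

⇉⇒→⊕ : M ⇉ (A , B) → M →⊕ [½ A ,½ B ]
⇉⇒→⊕ root     = choose □
⇉⇒→⊕ (appˡ r) with choose W ← ⇉⇒→⊕ r = choose (W ∙· _)
⇉⇒→⊕ (appʳ r) with choose W ← ⇉⇒→⊕ r = choose (_ ·∙ W)

→⊕⇒⇉ : ∀ {m} → M →⊕ m → ∃₂ λ A B → M ⇉ (A , B) × m ≡ [½ A ,½ B ]
→⊕⇒⇉ (choose W) = _ , _ , plug W , refl
  where
  plug : ∀ W → W ⟨ A ⊕ B ⟩ʷ ⇉ (W ⟨ A ⟩ʷ , W ⟨ B ⟩ʷ)
  plug □        = root
  plug (W ∙· _) = appˡ (plug W)
  plug (_ ·∙ W) = appʳ (plug W)

value-⇀ : Value V → ¬ V ⇀ N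
value-⇀ (var x) ()
value-⇀ (ƛ M)   ()

value-⇉ : ∀ {p} → Value V → ¬ V ⇉ p
value-⇉ (var x) ()
value-⇉ (ƛ M)   ()

-- Values take no weak step, so a root redex overlaps with no other step. Distinct weak redexes are
-- therefore disjoint, and neither copies nor erases the other.
⇀-diamond : M ⇀ A → M ⇀ B → A ≡ B ⊎ ∃ λ C → A ⇀ C × B ⇀ C
⇀-diamond (root v) (root _) = inj₁ refl
⇀-diamond (root v) (appˡ ())
⇀-diamond (root v) (appʳ s) = contradiction s (value-⇀ v)
⇀-diamond (appˡ ()) (root v)
⇀-diamond (appʳ r) (root v) = contradiction r (value-⇀ v)
⇀-diamond (appˡ r) (appʳ s) = inj₂ (_ , appʳ s , appˡ r)
⇀-diamond (appʳ r) (appˡ s) = inj₂ (_ , appˡ s , appʳ r)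
⇀-diamond (appˡ r) (appˡ s) with ⇀-diamond r s
... | inj₁ refl          = inj₁ refl
... | inj₂ (_ , s′ , r′) = inj₂ (_ , appˡ s′ , appˡ r′)
⇀-diamond (appʳ r) (appʳ s) with ⇀-diamond r s
... | inj₁ refl          = inj₁ refl
... | inj₂ (_ , s′ , r′) = inj₂ (_ , appʳ s′ , appʳ r′)

⇉-⇀-diamond : M ⇉ (A , B) → M ⇀ N → ∃₂ λ A′ B′ → A ⇀ A′ × B ⇀ B′ × N ⇉ (A′ , B′)
⇉-⇀-diamond root      ()
⇉-⇀-diamond (appˡ ()) (root v)
⇉-⇀-diamond (appʳ c)  (root v) = contradiction c (value-⇉ v)
⇉-⇀-diamond (appˡ c)  (appʳ r) = _ , _ , appʳ r , appʳ r , appˡ c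
⇉-⇀-diamond (appʳ c)  (appˡ r) = _ , _ , appˡ r , appˡ r , appʳ c
⇉-⇀-diamond (appˡ c)  (appˡ r) =
  let _ , _ , a , b , c′ = ⇉-⇀-diamond c r in _ , _ , appˡ a , appˡ b , appˡ c′
⇉-⇀-diamond (appʳ c)  (appʳ r) =
  let _ , _ , a , b , c′ = ⇉-⇀-diamond c r in _ , _ , appʳ a , appʳ b , appʳ c′

-- `AC` is the outcome of choosing `A` at one choice and `C` at the other, and likewise for the
-- other three.
record Square (A B C D : Term) : Set where
  constructor square
  field
    {AC AD BC BD} : Term
    top    : A ⇉ (AC , AD)
    bottom : B ⇉ (BC , BD)
    left   : C ⇉ (AC , BC)
    right  : D ⇉ (AD , BD)

⇉-diamond : M ⇉ (A , B) → M ⇉ (C , D) → (A ≡ C × B ≡ D) ⊎ Square A B C D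
⇉-diamond root     root     = inj₁ (refl , refl)
⇉-diamond (appˡ c) (appʳ d) = inj₂ (square (appʳ d) (appʳ d) (appˡ c) (appˡ c))
⇉-diamond (appʳ c) (appˡ d) = inj₂ (square (appˡ d) (appˡ d) (appʳ c) (appʳ c))
⇉-diamond (appˡ c) (appˡ d) with ⇉-diamond c d
... | inj₁ (refl , refl)    = inj₁ (refl , refl)
... | inj₂ (square t b l r) = inj₂ (square (appˡ t) (appˡ b) (appˡ l) (appˡ r))
⇉-diamond (appʳ c) (appʳ d) with ⇉-diamond c d
... | inj₁ (refl , refl)    = inj₁ (refl , refl)
... | inj₂ (square t b l r) = inj₂ (square (appʳ t) (appʳ b) (appʳ l) (appʳ r))

-- Variables are values, so replacing them by anything other than values could destroy a redex.
substitute-⇀ : Values σ → M ⇀ M′ → substitute σ M ⇀ substitute σ M′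
substitute-⇀ {σ = σ} vs (root {V} {M} v) =
  subst (substitute σ ((ƛ M) · V) ⇀_) (sym (substitute-⟦/0⟧ σ M V))
    (root {M = substitute (exts σ) M} (substitute-value vs v))
substitute-⇀ vs (appˡ r) = appˡ (substitute-⇀ vs r)
substitute-⇀ vs (appʳ r) = appʳ (substitute-⇀ vs r)

-- Parallel reduction

infix 4 _∥_ _∥ᵢ_ _⇓_

-- Parallel reduction in the style of Tait and Martin-Löf, for call-by-value β. It is stable under
-- substitution of parallel-reduced values, whatever the number of copies, and never resolves a
-- choice.
data _∥_ : Rel Term 0ℓ where
  var    : ∀ x → var x ∥ var x
  lam    : M ∥ M′ → ƛ M ∥ ƛ M′
  app    : M ∥ M′ → P ∥ P′ → M · P ∥ M′ · P′
  choice : M ∥ M′ → P ∥ P′ → M ⊕ P ∥ M′ ⊕ P′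
  beta   : Value V → M ∥ M′ → V ∥ V′ → (ƛ M) · V ∥ M′ ⟦ V′ /0⟧

-- Parallel reduction that contracts no redex in weak position.
data _∥ᵢ_ : Rel Term 0ℓ where
  var    : ∀ x → var x ∥ᵢ var x
  lam    : M ∥ M′ → ƛ M ∥ᵢ ƛ M′
  app    : M ∥ᵢ M′ → P ∥ᵢ P′ → M · P ∥ᵢ M′ · P′
  choice : M ∥ M′ → P ∥ P′ → M ⊕ P ∥ᵢ M′ ⊕ P′

∥-refl : M ∥ M
∥-refl {var x} = var x
∥-refl {ƛ M}   = lam ∥-refl
∥-refl {M · N} = app ∥-refl ∥-refl
∥-refl {M ⊕ N} = choice ∥-refl ∥-refl

∥ᵢ-refl : M ∥ᵢ M
∥ᵢ-refl {var x} = var x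
∥ᵢ-refl {ƛ M}   = lam ∥-refl
∥ᵢ-refl {M · N} = app ∥ᵢ-refl ∥ᵢ-refl
∥ᵢ-refl {M ⊕ N} = choice ∥-refl ∥-refl

∥ᵢ⇒∥ : M ∥ᵢ N → M ∥ N
∥ᵢ⇒∥ (var x)      = var x
∥ᵢ⇒∥ (lam r)      = lam r
∥ᵢ⇒∥ (app r s)    = app (∥ᵢ⇒∥ r) (∥ᵢ⇒∥ s)
∥ᵢ⇒∥ (choice r s) = choice r s

⇀⇒∥ : M ⇀ N → M ∥ N
⇀⇒∥ (root v) = beta v ∥-refl ∥-refl
⇀⇒∥ (appˡ r) = app (⇀⇒∥ r) ∥-refl
⇀⇒∥ (appʳ r) = app ∥-refl (⇀⇒∥ r)

→β⇒∥ : M →β N → M ∥ N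
→β⇒∥ (close C b) = plug C b
  where
  plug : ∀ C → P ↦β Q → C ⟨ P ⟩ ∥ C ⟨ Q ⟩
  plug □        (βv v) = beta v ∥-refl ∥-refl
  plug (_ ·∙ C) b      = app ∥-refl (plug C b)
  plug (C ∙· _) b      = app (plug C b) ∥-refl
  plug (ƛ C)    b      = lam (plug C b)
  plug (C ∙⊕ _) b      = choice (plug C b) ∥-refl
  plug (_ ⊕∙ C) b      = choice ∥-refl (plug C b)

value-∥ : Value V → V ∥ V′ → Value V′ × V ∥ᵢ V′
value-∥ (var x) (var x) = var x , var x
value-∥ (ƛ M)   (lam r) = ƛ _ , lam r

∥ᵢ-value : V ∥ᵢ V′ → Value V′ → Value V
∥ᵢ-value (var x) (var x) = var x
∥ᵢ-value (lam r) (ƛ M)   = ƛ _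

rename-∥ : ∀ ρ → M ∥ M′ → rename ρ M ∥ rename ρ M′
rename-∥ ρ (var x)      = var (ρ x)
rename-∥ ρ (lam r)      = lam (rename-∥ (ext ρ) r)
rename-∥ ρ (app r s)    = app (rename-∥ ρ r) (rename-∥ ρ s)
rename-∥ ρ (choice r s) = choice (rename-∥ ρ r) (rename-∥ ρ s)
rename-∥ ρ (beta {M′ = M′} {V′ = V′} v r s) =
  subst (_ ∥_) (sym (rename-⟦/0⟧ ρ M′ V′))
    (beta (rename-value v) (rename-∥ (ext ρ) r) (rename-∥ ρ s))

exts-∥ : (∀ x → σ x ∥ τ x) → ∀ x → exts σ x ∥ exts τ x
exts-∥ h zero    = var 0
exts-∥ h (suc x) = rename-∥ suc (h x)

substitute-∥ : Values σ → (∀ x → σ x ∥ τ x) →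
               M ∥ M′ → substitute σ M ∥ substitute τ M′
substitute-∥ vs h (var x)      = h x
substitute-∥ vs h (lam r)      = lam (substitute-∥ (exts-values vs) (exts-∥ h) r)
substitute-∥ vs h (app r s)    = app (substitute-∥ vs h r) (substitute-∥ vs h s)
substitute-∥ vs h (choice r s) = choice (substitute-∥ vs h r) (substitute-∥ vs h s)
substitute-∥ {τ = τ} vs h (beta {M′ = M′} {V′ = V′} v r s) =
  subst (_ ∥_) (sym (substitute-⟦/0⟧ τ M′ V′))
    (beta (substitute-value vs v)
      (substitute-∥ (exts-values vs) (exts-∥ h) r) (substitute-∥ vs h s))

-- Only values are substituted, so no redex appears in weak position.
substitute-∥ᵢ : Values σ → (∀ x → σ x ∥ τ x) →
                M ∥ᵢ M′ → substitute σ M ∥ᵢ substitute τ M′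
substitute-∥ᵢ vs h (var x)      = proj₂ (value-∥ (vs x) (h x))
substitute-∥ᵢ vs h (lam r)      = lam (substitute-∥ (exts-values vs) (exts-∥ h) r)
substitute-∥ᵢ vs h (app r s)    = app (substitute-∥ᵢ vs h r) (substitute-∥ᵢ vs h s)
substitute-∥ᵢ vs h (choice r s) = choice (substitute-∥ vs h r) (substitute-∥ vs h s)

⟦/0⟧-⇀ : Value V → M ⇀ M′ → M ⟦ V /0⟧ ⇀ M′ ⟦ V /0⟧
⟦/0⟧-⇀ v r = substitute-⇀ (λ { zero → v ; (suc x) → var x }) r

⟦/0⟧-∥ : Value V → V ∥ V′ → M ∥ M′ → M ⟦ V /0⟧ ∥ M′ ⟦ V′ /0⟧
⟦/0⟧-∥ v p r = substitute-∥ (λ { zero → v ; (suc x) → var x })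
                            (λ { zero → p ; (suc x) → var x }) r

⟦/0⟧-∥ᵢ : Value V → V ∥ V′ → M ∥ᵢ M′ → M ⟦ V /0⟧ ∥ᵢ M′ ⟦ V′ /0⟧
⟦/0⟧-∥ᵢ v p r = substitute-∥ᵢ (λ { zero → v ; (suc x) → var x })
                              (λ { zero → p ; (suc x) → var x }) r

infix 4 _⇀*_

_⇀*_ : Rel Term 0ℓ
_⇀*_ = Star _⇀_

-- In the `beta` case the redex is contracted first, and the weak steps of the body follow under the
-- substitution. The argument is a value, so its own reductions are internal wherever it is copied.
factor : M ∥ N → ∃ λ L → M ⇀* L × L ∥ᵢ N
factor (var x)      = _ , ε , var x
factor (lam r)      = _ , ε , lam r
factor (choice r s) = _ , ε , choice r s
factor (app r s)    =
  let _ , r₁ , r₂ = factor r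
      _ , s₁ , s₂ = factor s
  in _ , gmap (_· _) appˡ r₁ ◅◅ gmap (_ ·_) appʳ s₁ , app r₂ s₂
factor (beta v r s) =
  let _ , r₁ , r₂ = factor r
  in _ , root v ◅ gmap (_⟦ _ /0⟧) (⟦/0⟧-⇀ v) r₁ , ⟦/0⟧-∥ᵢ v s r₂

-- Internal reduction keeps the weak skeleton, so the redex is already present in `M`. Contracting
-- it can expose the body in weak position, hence the closing step is `∥` and not `∥ᵢ`.
∥ᵢ-⇀ : M ∥ᵢ M′ → M′ ⇀ N → ∃ λ L → M ⇀ L × L ∥ N
∥ᵢ-⇀ (app (lam r) s) (root v) =
  let v′ = ∥ᵢ-value s v in _ , root v′ , ⟦/0⟧-∥ v′ (∥ᵢ⇒∥ s) r
∥ᵢ-⇀ (app r s) (appˡ t) =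
  let _ , t′ , r′ = ∥ᵢ-⇀ r t in _ , appˡ t′ , app r′ (∥ᵢ⇒∥ s)
∥ᵢ-⇀ (app r s) (appʳ t) =
  let _ , t′ , s′ = ∥ᵢ-⇀ s t in _ , appʳ t′ , app (∥ᵢ⇒∥ r) s′

∥ᵢ-⇉ : M ∥ᵢ M′ → M′ ⇉ (A , B) → ∃₂ λ A′ B′ → M ⇉ (A′ , B′) × A′ ∥ A × B′ ∥ B
∥ᵢ-⇉ (choice r s) root = _ , _ , root , r , s
∥ᵢ-⇉ (app r s) (appˡ c) =
  let _ , _ , c′ , a , b = ∥ᵢ-⇉ r c
  in _ , _ , appˡ c′ , app a (∥ᵢ⇒∥ s) , app b (∥ᵢ⇒∥ s)
∥ᵢ-⇉ (app r s) (appʳ c) =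
  let _ , _ , c′ , a , b = ∥ᵢ-⇉ s c
  in _ , _ , appʳ c′ , app (∥ᵢ⇒∥ r) a , app (∥ᵢ⇒∥ r) b

-- Existence of a step is all that the transfer of normality from `M′` to `M` requires.
⇀-∥ᵢ : M ∥ᵢ M′ → M ⇀ L → ∃ λ N → M′ ⇀ N
⇀-∥ᵢ (app (lam r) s) (root v) = _ , root (proj₁ (value-∥ v (∥ᵢ⇒∥ s)))
⇀-∥ᵢ (app r s)       (appˡ t) = let _ , t′ = ⇀-∥ᵢ r t in _ , appˡ t′
⇀-∥ᵢ (app r s)       (appʳ t) = let _ , t′ = ⇀-∥ᵢ s t in _ , appʳ t′

⇉-∥ᵢ : ∀ {p} → M ∥ᵢ M′ → M ⇉ p → ∃ λ q → M′ ⇉ q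
⇉-∥ᵢ (choice r s) root     = _ , root
⇉-∥ᵢ (app r s)    (appˡ c) = let _ , c′ = ⇉-∥ᵢ r c in _ , appˡ c′
⇉-∥ᵢ (app r s)    (appʳ c) = let _ , c′ = ⇉-∥ᵢ s c in _ , appʳ c′

weakNormal-∥ᵢ : M ∥ᵢ M′ → WeakNormal M → WeakNormal M′
weakNormal-∥ᵢ i n (_ , r) = let _ , r′ , _ = ∥ᵢ-⇀ i (→w⇒⇀ r) in n (_ , ⇀⇒→w r′)

weakNormal-∥ᵢ⁻ : M ∥ᵢ M′ → WeakNormal M′ → WeakNormal M
weakNormal-∥ᵢ⁻ i n (_ , r) = let _ , r′ = ⇀-∥ᵢ i (→w⇒⇀ r) in n (_ , ⇀⇒→w r′)

surfaceNormal-∥ᵢ : M ∥ᵢ M′ → SurfaceNormal M → SurfaceNormal M′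
surfaceNormal-∥ᵢ i n (_ , byβ r) =
  let _ , r′ , _ = ∥ᵢ-⇀ i (→w⇒⇀ r) in n (_ , byβ (⇀⇒→w r′))
surfaceNormal-∥ᵢ i n (_ , by⊕ c) =
  let _ , _ , c′ , _ = →⊕⇒⇉ c
      _ , _ , c″ , _ = ∥ᵢ-⇉ i c′
  in n (_ , by⊕ (⇉⇒→⊕ c″))

surfaceNormal-∥ᵢ⁻ : M ∥ᵢ M′ → SurfaceNormal M′ → SurfaceNormal M
surfaceNormal-∥ᵢ⁻ i n (_ , byβ r) =
  let _ , r′ = ⇀-∥ᵢ i (→w⇒⇀ r) in n (_ , byβ (⇀⇒→w r′))
surfaceNormal-∥ᵢ⁻ i n (_ , by⊕ c) =
  let _ , _ , c′ , _ = →⊕⇒⇉ c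
      _ , c″ = ⇉-∥ᵢ i c′
  in n (_ , by⊕ (⇉⇒→⊕ c″))

surfaceNormal⇒weakNormal : SurfaceNormal M → WeakNormal M
surfaceNormal⇒weakNormal n (_ , r) = n (_ , byβ r)

-- Unbiased iteration of weak reduction

weakNormalˡ : WeakNormal (P · Q) → WeakNormal P
weakNormalˡ n (_ , r) = n (_ , ⇀⇒→w (appˡ (→w⇒⇀ r)))

weakNormalʳ : WeakNormal (P · Q) → WeakNormal Q
weakNormalʳ n (_ , r) = n (_ , ⇀⇒→w (appʳ (→w⇒⇀ r)))

weakNormal-ƛ : WeakNormal (ƛ M)
weakNormal-ƛ (_ , r) = value-⇀ (ƛ _) (→w⇒⇀ r)

weakNormal-⊕ : WeakNormal (M ⊕ N)
weakNormal-⊕ (_ , r) with () ← →w⇒⇀ r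

⇝U⇒∥ : M ⇝U N → M ∥ N
⇝U⇒∥ (weak r)   = ⇀⇒∥ (→w⇒⇀ r)
⇝U⇒∥ (lam _ r)  = lam (⇝U⇒∥ r)
⇝U⇒∥ (appˡ _ r) = app (⇝U⇒∥ r) ∥-refl
⇝U⇒∥ (appʳ _ r) = app ∥-refl (⇝U⇒∥ r)
⇝U⇒∥ (sumˡ _ r) = choice (⇝U⇒∥ r) ∥-refl
⇝U⇒∥ (sumʳ _ r) = choice ∥-refl (⇝U⇒∥ r)

-- Subterms in weak position are weak normal too, so the contracted redex lies below the weak
-- skeleton. This is why `⇝U` preserves weak and surface normality.
⇝U⇒∥ᵢ : WeakNormal M → M ⇝U N → M ∥ᵢ N
⇝U⇒∥ᵢ n (weak r)   = contradiction (_ , r) n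
⇝U⇒∥ᵢ n (lam _ r)  = lam (⇝U⇒∥ r)
⇝U⇒∥ᵢ n (appˡ _ r) = app (⇝U⇒∥ᵢ (weakNormalˡ n) r) ∥ᵢ-refl
⇝U⇒∥ᵢ n (appʳ _ r) = app ∥ᵢ-refl (⇝U⇒∥ᵢ (weakNormalʳ n) r)
⇝U⇒∥ᵢ n (sumˡ _ r) = choice (⇝U⇒∥ r) ∥-refl
⇝U⇒∥ᵢ n (sumʳ _ r) = choice ∥-refl (⇝U⇒∥ r)

⇝U-weakNormal : WeakNormal M → M ⇝U N → WeakNormal N
⇝U-weakNormal n r = weakNormal-∥ᵢ (⇝U⇒∥ᵢ n r) n

⇝U-surfaceNormal : SurfaceNormal M → M ⇝U N → SurfaceNormal N
⇝U-surfaceNormal n r = surfaceNormal-∥ᵢ (⇝U⇒∥ᵢ (surfaceNormal⇒weakNormal n) r) n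

-- The side conditions rule out a weak step against a deeper one. Deeper steps in different
-- components commute, and `⇝U-weakNormal` restores the side condition for the closing steps.
⇝U-diamond : M ⇝U A → M ⇝U B → A ≡ B ⊎ ∃ λ C → A ⇝U C × B ⇝U C
⇝U-diamond (weak r) (weak s) with ⇀-diamond (→w⇒⇀ r) (→w⇒⇀ s)
... | inj₁ refl          = inj₁ refl
... | inj₂ (_ , s′ , r′) = inj₂ (_ , weak (⇀⇒→w s′) , weak (⇀⇒→w r′))
⇝U-diamond (weak r)   (lam n _)  = contradiction (_ , r) n
⇝U-diamond (weak r)   (appˡ n _) = contradiction (_ , r) n
⇝U-diamond (weak r)   (appʳ n _) = contradiction (_ , r) n
⇝U-diamond (weak r)   (sumˡ n _) = contradiction (_ , r) n
⇝U-diamond (weak r)   (sumʳ n _) = contradiction (_ , r) n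
⇝U-diamond (lam n _)  (weak r)   = contradiction (_ , r) n
⇝U-diamond (appˡ n _) (weak r)   = contradiction (_ , r) n
⇝U-diamond (appʳ n _) (weak r)   = contradiction (_ , r) n
⇝U-diamond (sumˡ n _) (weak r)   = contradiction (_ , r) n
⇝U-diamond (sumʳ n _) (weak r)   = contradiction (_ , r) n
⇝U-diamond (lam _ r) (lam _ s) with ⇝U-diamond r s
... | inj₁ refl          = inj₁ refl
... | inj₂ (_ , s′ , r′) = inj₂ (_ , lam weakNormal-ƛ s′ , lam weakNormal-ƛ r′)
⇝U-diamond (appˡ n r) (appˡ _ s) with ⇝U-diamond r s
... | inj₁ refl          = inj₁ refl
... | inj₂ (_ , s′ , r′) = inj₂ (_ , appˡ (⇝U-weakNormal n (appˡ n r)) s′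
                                   , appˡ (⇝U-weakNormal n (appˡ n s)) r′)
⇝U-diamond (appʳ n r) (appʳ _ s) with ⇝U-diamond r s
... | inj₁ refl          = inj₁ refl
... | inj₂ (_ , s′ , r′) = inj₂ (_ , appʳ (⇝U-weakNormal n (appʳ n r)) s′
                                   , appʳ (⇝U-weakNormal n (appʳ n s)) r′)
⇝U-diamond (appˡ n r) (appʳ _ s) =
  inj₂ (_ , appʳ (⇝U-weakNormal n (appˡ n r)) s , appˡ (⇝U-weakNormal n (appʳ n s)) r)
⇝U-diamond (appʳ n r) (appˡ _ s) =
  inj₂ (_ , appˡ (⇝U-weakNormal n (appʳ n r)) s , appʳ (⇝U-weakNormal n (appˡ n s)) r)
⇝U-diamond (sumˡ _ r) (sumˡ _ s) with ⇝U-diamond r s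
... | inj₁ refl          = inj₁ refl
... | inj₂ (_ , s′ , r′) = inj₂ (_ , sumˡ weakNormal-⊕ s′ , sumˡ weakNormal-⊕ r′)
⇝U-diamond (sumʳ _ r) (sumʳ _ s) with ⇝U-diamond r s
... | inj₁ refl          = inj₁ refl
... | inj₂ (_ , s′ , r′) = inj₂ (_ , sumʳ weakNormal-⊕ s′ , sumʳ weakNormal-⊕ r′)
⇝U-diamond (sumˡ _ r) (sumʳ _ s) = inj₂ (_ , sumʳ weakNormal-⊕ s , sumˡ weakNormal-⊕ r)
⇝U-diamond (sumʳ _ r) (sumˡ _ s) = inj₂ (_ , sumˡ weakNormal-⊕ s , sumʳ weakNormal-⊕ r)

→β-appˡ : M →β M′ → M · N →β M′ · N
→β-appˡ (close C b) = close (C ∙· _) b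

→β-appʳ : M →β M′ → N · M →β N · M′
→β-appʳ (close C b) = close (_ ·∙ C) b

⇝U⇒→β : M ⇝U N → M →β N
⇝U⇒→β (weak (close W b)) = plug W b
  where
  plug : ∀ W → P ↦β Q → W ⟨ P ⟩ʷ →β W ⟨ Q ⟩ʷ
  plug □        b = close □ b
  plug (W ∙· _) b = →β-appˡ (plug W b)
  plug (_ ·∙ W) b = →β-appʳ (plug W b)
⇝U⇒→β (lam _ r)  with close C b ← ⇝U⇒→β r = close (ƛ C) b
⇝U⇒→β (appˡ _ r) = →β-appˡ (⇝U⇒→β r)
⇝U⇒→β (appʳ _ r) = →β-appʳ (⇝U⇒→β r)
⇝U⇒→β (sumˡ _ r) with close C b ← ⇝U⇒→β r = close (C ∙⊕ _) b
⇝U⇒→β (sumʳ _ r) with close C b ← ⇝U⇒→β r = close (_ ⊕∙ C) b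

-- Only `app` needs a side condition: variables, abstractions and choices are always weak normal.
data _⇓_ : Rel Term 0ℓ where
  weak   : M ⇀ M′ → M′ ⇓ N → M ⇓ N
  var    : ∀ x → var x ⇓ var x
  lam    : M ⇓ M′ → ƛ M ⇓ ƛ M′
  app    : WeakNormal (M · P) → M ⇓ M′ → P ⇓ P′ → M · P ⇓ M′ · P′
  choice : M ⇓ M′ → P ⇓ P′ → M ⊕ P ⇓ M′ ⊕ P′

⇀*-⇓ : M ⇀* M′ → M′ ⇓ N → M ⇓ N
⇀*-⇓ ε        e = e
⇀*-⇓ (r ◅ rs) e = weak r (⇀*-⇓ rs e)

-- The recursion is on the `⇓`-derivation, since pulling back a weak step may enlarge the parallel
-- step. After the weak steps given by `factor`, `internal` follows the derivation: a weak step is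
-- pulled back, any other rule passes to the components.
∥-⇓ : M ∥ M′ → M′ ⇓ N → M ⇓ N
∥-⇓ p e with _ , rs , i ← factor p = ⇀*-⇓ rs (internal i e)
  where
  internal : M ∥ᵢ M′ → M′ ⇓ N → M ⇓ N
  internal i            (weak r e)  = let _ , r′ , p = ∥ᵢ-⇀ i r in weak r′ (∥-⇓ p e)
  internal (var x)      (var x)     = var x
  internal (lam p)      (lam e)     = lam (∥-⇓ p e)
  internal (choice p q) (choice e f) = choice (∥-⇓ p e) (∥-⇓ q f)
  internal i@(app p q)  (app n e f) =
    app (weakNormal-∥ᵢ⁻ i n) (∥-⇓ (∥ᵢ⇒∥ p) e) (∥-⇓ (∥ᵢ⇒∥ q) f)

infix 4 _⇝U*_

_⇝U*_ : Rel Term 0ℓ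
_⇝U*_ = Star _⇝U_

⇝U*-app : WeakNormal (M · P) → M ⇝U* M′ → P ⇝U* P′ → M · P ⇝U* M′ · P′
⇝U*-app n ε        ε        = ε
⇝U*-app n (r ◅ rs) ss       = appˡ n r ◅ ⇝U*-app (⇝U-weakNormal n (appˡ n r)) rs ss
⇝U*-app n ε        (s ◅ ss) = appʳ n s ◅ ⇝U*-app (⇝U-weakNormal n (appʳ n s)) ε ss

⇓⇒⇝U* : M ⇓ N → M ⇝U* N
⇓⇒⇝U* (weak r e)   = weak (⇀⇒→w r) ◅ ⇓⇒⇝U* e
⇓⇒⇝U* (var x)      = ε
⇓⇒⇝U* (lam e)      = gmap ƛ_ (lam weakNormal-ƛ) (⇓⇒⇝U* e)
⇓⇒⇝U* (app n e f)  = ⇝U*-app n (⇓⇒⇝U* e) (⇓⇒⇝U* f)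
⇓⇒⇝U* (choice e f) = gmap (_⊕ _) (sumˡ weakNormal-⊕) (⇓⇒⇝U* e)
                  ◅◅ gmap (_ ⊕_) (sumʳ weakNormal-⊕) (⇓⇒⇝U* f)

βNormal : Term → Set
βNormal M = ¬ ∃ λ N → M →β N

⇓-βNormal : ∀ M → βNormal M → M ⇓ M
⇓-βNormal (var x) n = var x
⇓-βNormal (ƛ M)   n = lam (⇓-βNormal M λ { (_ , close C b) → n (_ , close (ƛ C) b) })
⇓-βNormal (M · P) n = app (λ (_ , r) → n (_ , ⇝U⇒→β (weak r)))
  (⇓-βNormal M λ { (_ , close C b) → n (_ , close (C ∙· _) b) })
  (⇓-βNormal P λ { (_ , close C b) → n (_ , close (_ ·∙ C) b) })
⇓-βNormal (M ⊕ P) n = choice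
  (⇓-βNormal M λ { (_ , close C b) → n (_ , close (C ∙⊕ _) b) })
  (⇓-βNormal P λ { (_ , close C b) → n (_ , close (_ ⊕∙ C) b) })

-- Progress

value? : ∀ M → Dec (Value M)
value? (var x) = yes (var x)
value? (ƛ M)   = yes (ƛ M)
value? (_ · _) = no λ ()
value? (_ ⊕ _) = no λ ()

⇀? : ∀ M → Dec (∃ λ N → M ⇀ N)
⇀? (var x) = no λ ()
⇀? (ƛ M)   = no λ ()
⇀? (M ⊕ N) = no λ ()
⇀? (M · N) with ⇀? M | ⇀? N
... | yes (_ , r) | _           = yes (_ , appˡ r)
... | no _        | yes (_ , r) = yes (_ , appʳ r)
⇀? ((ƛ M) · N) | no ¬r | no ¬s with value? N
... | yes v = yes (_ , root v)
... | no ¬v = no λ { (_ , root v) → ¬v v ; (_ , appʳ s) → ¬s (_ , s) }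
⇀? (var x   · N) | no ¬r | no ¬s = no λ { (_ , appʳ s) → ¬s (_ , s) }
⇀? ((_ · _) · N) | no ¬r | no ¬s =
  no λ { (_ , appˡ r) → ¬r (_ , r) ; (_ , appʳ s) → ¬s (_ , s) }
⇀? ((_ ⊕ _) · N) | no ¬r | no ¬s = no λ { (_ , appʳ s) → ¬s (_ , s) }

⇉? : ∀ M → Dec (∃ λ p → M ⇉ p)
⇉? (var x) = no λ ()
⇉? (ƛ M)   = no λ ()
⇉? (M ⊕ N) = yes (_ , root)
⇉? (M · N) with ⇉? M | ⇉? N
... | yes (_ , c) | _           = yes (_ , appˡ c)
... | no _        | yes (_ , c) = yes (_ , appʳ c)
... | no ¬c       | no ¬d       =
  no λ { (_ , appˡ c) → ¬c (_ , c) ; (_ , appʳ d) → ¬d (_ , d) }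

⇝U-progress : ∀ M → (∃ λ N → M ⇝U N) ⊎ βNormal M
⇝U-progress M with ⇀? M
... | yes (_ , r) = inj₁ (_ , weak (⇀⇒→w r))
... | no  ¬r      = go M ¬r
  where
  go : ∀ M → ¬ (∃ λ N → M ⇀ N) → (∃ λ N → M ⇝U N) ⊎ βNormal M
  go (var x) ¬r = inj₂ λ (_ , r) → lemma r refl
    where
    -- The source of `close C b` is the function application `C ⟨ P ⟩`, so it is compared with the
    -- given term through an equation; likewise below.
    lemma : L →β N → ¬ L ≡ var x
    lemma (close □ (βv v)) ()
  go (ƛ M)   ¬r with ⇝U-progress M
  ... | inj₁ (_ , r) = inj₁ (_ , lam weakNormal-ƛ r)
  ... | inj₂ n       = inj₂ λ (_ , r) → lemma r refl
    where
    lemma : L →β N → ¬ L ≡ ƛ M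
    lemma (close (ƛ C) b) refl = n (_ , close C b)
    lemma (close □ (βv v)) ()
  go (M · P) ¬r with ⇝U-progress M | ⇝U-progress P
  ... | inj₁ (_ , r) | _            = inj₁ (_ , appˡ (λ (_ , w) → ¬r (_ , →w⇒⇀ w)) r)
  ... | inj₂ _       | inj₁ (_ , r) = inj₁ (_ , appʳ (λ (_ , w) → ¬r (_ , →w⇒⇀ w)) r)
  ... | inj₂ m       | inj₂ p       = inj₂ λ (_ , r) → lemma r refl
    where
    lemma : L →β N → ¬ L ≡ M · P
    lemma (close □        (βv v)) refl = ¬r (_ , root v)
    lemma (close (C ∙· _) b)      refl = m (_ , close C b)
    lemma (close (_ ·∙ C) b)      refl = p (_ , close C b)
  go (M ⊕ P) ¬r with ⇝U-progress M | ⇝U-progress P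
  ... | inj₁ (_ , r) | _            = inj₁ (_ , sumˡ weakNormal-⊕ r)
  ... | inj₂ _       | inj₁ (_ , r) = inj₁ (_ , sumʳ weakNormal-⊕ r)
  ... | inj₂ m       | inj₂ p       = inj₂ λ (_ , r) → lemma r refl
    where
    lemma : L →β N → ¬ L ≡ M ⊕ P
    lemma (close (C ∙⊕ _) b) refl = m (_ , close C b)
    lemma (close (_ ⊕∙ C) b) refl = p (_ , close C b)
    lemma (close □ (βv v)) ()

-- The alternatives match the rules `step` and `idle` of the full lifting, so every term has a
-- lifted move, found constructively.
⇝E-progress : ∀ M → (∃ λ m → M ⇝E m) ⊎ Normal M
⇝E-progress M with ⇀? M | ⇉? M
... | yes (_ , r) | _ =
  let s = byβ (⇀⇒→w r) in inj₁ (_ , surface (λ n → n (_ , s)) s)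
... | no _ | yes (_ , c) =
  let s = by⊕ (⇉⇒→⊕ c) in inj₁ (_ , surface (λ n → n (_ , s)) s)
... | no ¬r | no ¬c with ⇝U-progress M
...   | inj₁ (_ , r) = inj₁ (_ , inner surfaceNormal r)
  where
  surfaceNormal : SurfaceNormal M
  surfaceNormal (_ , byβ r) = ¬r (_ , →w⇒⇀ r)
  surfaceNormal (_ , by⊕ c) = let _ , _ , c′ , _ = →⊕⇒⇉ c in ¬c (_ , c′)
...   | inj₂ n = inj₂ λ where
  (_ , byβ r) → n (_ , r)
  (_ , by⊕ c) → let _ , _ , c′ , _ = →⊕⇒⇉ c in ¬c (_ , c′)

-- Weighted sums

private
  variable
    x y z : ℝ≥0
    es fs : Weighted

-- `F M x` is read as: `x` is a certified lower bound for a quantity attached to `M`. A relation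
-- avoids having to compute that quantity.
Valuation : Set₂
Valuation = Term → ℝ≥0 → Set₁

-- Lift F es x says that x is at most the sum of p ⊛ y over the entries
-- (p , M) of es, for some choice of values y with F M y.
data Lift (F : Valuation) : Weighted → ℝ≥0 → Set₁ where
  nil  : x ≼ 0ℝ → Lift F [] x
  cons : ∀ {p} → F M y → Lift F es z → x ≼ p ⊛ y ⊹ z → Lift F ((p , M) ∷ es) x

DownClosed : Valuation → Set₁
DownClosed F = ∀ {M x y} → x ≼ y → F M y → F M x

module _ {F : Valuation} where

  Lift-≼ : x ≼ y → Lift F es y → Lift F es x
  Lift-≼ x≼y (nil y≼)      = nil (x≼y ⨾ y≼)
  Lift-≼ x≼y (cons f l y≼) = cons f l (x≼y ⨾ y≼)

  Lift-map : ∀ {G} → (∀ {M x} → F M x → G M x) → Lift F es x → Lift G es x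
  Lift-map g (nil x≼)      = nil x≼
  Lift-map g (cons f l x≼) = cons (g f) (Lift-map g l) x≼

  Lift-++ : Lift F es x → Lift F fs y → Lift F (es ++ fs) (x ⊹ y)
  Lift-++ (nil x≼) k = Lift-≼ (⊹-mono x≼ ≼-refl ⨾ ⊹-identityˡ _) k
  Lift-++ (cons f l x≼) k = cons f (Lift-++ l k) (⊹-mono x≼ ≼-refl ⨾ ⊹-assoc _ _ _)

  Lift-++⁻ : ∀ es → Lift F (es ++ fs) x →
             ∃₂ λ y z → Lift F es y × Lift F fs z × x ≼ y ⊹ z
  Lift-++⁻ []       l             = _ , _ , nil ≼-refl , l , y≼x⊹y 0ℝ _
  Lift-++⁻ (_ ∷ es) (cons f l x≼) =
    let _ , _ , l₁ , l₂ , z≼ = Lift-++⁻ es l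
    in _ , _ , cons f l₁ ≼-refl , l₂ , x≼ ⨾ ⊹-mono ≼-refl z≼ ⨾ ⊹-assoc˘ _ _ _

  Lift-⊙ : ∀ q → Lift F es x → Lift F (q ⊙ es) (q ⊛ x)
  Lift-⊙ q (nil x≼)      = nil (⊛-monoʳ q x≼ ⨾ ⊛-zeroʳ q)
  Lift-⊙ q (cons {p = p} f l x≼) = cons f (Lift-⊙ q l)
    (⊛-monoʳ q x≼ ⨾ ⊛-distribˡ q _ _ ⨾ ⊹-mono (*-⊛-assoc˘ q p _) ≼-refl)

  Lift-⊙⁻ : ∀ q es → Lift F (q ⊙ es) x → ∃ λ y → Lift F es y × x ≼ q ⊛ y
  Lift-⊙⁻ q []       (nil x≼)      = 0ℝ , nil ≼-refl , x≼ ⨾ 0≼ _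
  Lift-⊙⁻ q ((p , _) ∷ es) (cons f l x≼) =
    let _ , l′ , z≼ = Lift-⊙⁻ q es l
    in _ , cons f l′ ≼-refl , x≼ ⨾ ⊹-mono (*-⊛-assoc q p _) z≼ ⨾ ⊛-distribˡ˘ q _ _

  Lift-↭ : es ↭ fs → Lift F es x → Lift F fs x
  Lift-↭ (Permutation.refl []) l = l
  Lift-↭ (Permutation.refl ((p≈q , refl) ∷ es≈fs)) (cons f l x≼) =
    cons f (Lift-↭ (Permutation.refl es≈fs) l)
      (x≼ ⨾ ⊹-mono (⊛-mono (up (proj₁ p≈q)) ≼-refl) ≼-refl)
  Lift-↭ (Permutation.prep (p≈q , refl) es↭fs) (cons f l x≼) =
    cons f (Lift-↭ es↭fs l) (x≼ ⨾ ⊹-mono (⊛-mono (up (proj₁ p≈q)) ≼-refl) ≼-refl)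
  Lift-↭ (Permutation.swap (p≈p′ , refl) (q≈q′ , refl) es↭fs)
         (cons f (cons g l y≼) x≼) =
    cons g (cons f (Lift-↭ es↭fs l) ≼-refl)
      (x≼ ⨾ ⊹-mono (⊛-mono (up (proj₁ p≈p′)) ≼-refl)
              (y≼ ⨾ ⊹-mono (⊛-mono (up (proj₁ q≈q′)) ≼-refl) ≼-refl)
          ⨾ ⊹-exchange _ _ _)
  Lift-↭ (Permutation.trans es↭fs fs↭gs) l = Lift-↭ fs↭gs (Lift-↭ es↭fs l)

  Lift-[] : F M x → Lift F (entries [ M ]) x
  Lift-[] f = cons f (nil ≼-refl) (⊛-identityˡ˘ _ ⨾ x≼x⊹y _ _)

  Lift-[½] : F A x → F B y → Lift F (entries [½ A ,½ B ]) (½ℝ ⊛ x ⊹ ½ℝ ⊛ y)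
  Lift-[½] f g = cons f (cons g (nil ≼-refl) (x≼x⊹y _ _)) ≼-refl

  Lift-[½]⁻ : Lift F (entries [½ A ,½ B ]) x →
              ∃₂ λ y z → F A y × F B z × x ≼ ½ℝ ⊛ y ⊹ ½ℝ ⊛ z
  Lift-[½]⁻ (cons f (cons g (nil w≼) z≼) x≼) =
    _ , _ , f , g , x≼ ⨾ ⊹-mono ≼-refl (z≼ ⨾ ⊹-mono ≼-refl w≼ ⨾ ⊹-identityʳ _)

  Lift-[]⁻ : DownClosed F → Lift F (entries [ M ]) x → F M x
  Lift-[]⁻ ↓ (cons f (nil z≼) x≼) =
    ↓ (x≼ ⨾ ⊹-mono (⊛-identityˡ _) z≼ ⨾ ⊹-identityʳ _) f

-- The list in the rule `mix`, with its entries as an explicit argument so that proofs can recurse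
-- on them.
mixture : (es : Weighted) → (Fin (length es) → MDist) → Weighted
mixture es ns = concat (tabulate λ i → proj₁ (lookup es i) ⊙ entries (ns i))

Lift-mixture : ∀ {F G} es (ns : Fin (length es) → MDist) →
  (∀ i {x} → F (proj₂ (lookup es i)) x → Lift G (entries (ns i)) x) →
  Lift F es x → Lift G (mixture es ns) x
Lift-mixture []       ns h (nil x≼)              = nil x≼
Lift-mixture (_ ∷ es) ns h (cons {p = p} f l x≼) =
  Lift-≼ x≼ (Lift-++ (Lift-⊙ p (h zero f)) (Lift-mixture es (ns ∘ suc) (h ∘ suc) l))

Lift-mixture⁻ : ∀ {F G} es (ns : Fin (length es) → MDist) →
  (∀ i {x} → Lift G (entries (ns i)) x → F (proj₂ (lookup es i)) x) →
  Lift G (mixture es ns) x → Lift F es x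
Lift-mixture⁻ []             ns h (nil x≼) = nil x≼
Lift-mixture⁻ ((p , _) ∷ es) ns h l =
  let _ , _ , l₁ , l₂ , x≼ = Lift-++⁻ (p ⊙ entries (ns zero)) l
      _ , l₁′ , y≼ = Lift-⊙⁻ p (entries (ns zero)) l₁
  in cons (h zero l₁′) (Lift-mixture⁻ es (ns ∘ suc) (h ∘ suc) l₂)
       (x≼ ⨾ ⊹-mono y≼ ≼-refl)

module _ {ℓ} {Idle : Pred Term ℓ} {r : Term → MDist → Set₁} {F G : Valuation} where

  -- Bounds are pushed forward here and pulled back in `Lift-Lifting⁻`, given only the behaviour on
  -- single terms. `F` and `G` may differ, which lets a step bound decrease along the way.
  Lift-Lifting : DownClosed F →
    (∀ {M x} → Idle M → F M x → G M x) →
    (∀ {M m x} → r M m → F M x → Lift G (entries m) x) →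
    ∀ {m n} → Lifting Idle r m n → Lift F (entries m) x → Lift G (entries n) x
  Lift-Lifting ↓ i s (idle M∈Idle)  l = Lift-[] (i M∈Idle (Lift-[]⁻ ↓ l))
  Lift-Lifting ↓ i s (step Mrm)     l = s Mrm (Lift-[]⁻ ↓ l)
  Lift-Lifting ↓ i s (mix {m} ns ls n↭) l =
    Lift-↭ (↭-sym n↭) (Lift-mixture (entries m) ns
      (λ j f → Lift-Lifting ↓ i s (ls j) (Lift-[] f)) l)
  Lift-Lifting ↓ i s (resp m≋ n≋ k) l =
    Lift-↭ n≋ (Lift-Lifting ↓ i s k (Lift-↭ (↭-sym m≋) l))

  Lift-Lifting⁻ : DownClosed F → DownClosed G →
    (∀ {M x} → Idle M → G M x → F M x) →
    (∀ {M m x} → r M m → Lift G (entries m) x → F M x) →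
    ∀ {m n} → Lifting Idle r m n → Lift G (entries n) x → Lift F (entries m) x
  Lift-Lifting⁻ ↓ ↓′ i s (idle M∈Idle)  l = Lift-[] (i M∈Idle (Lift-[]⁻ ↓′ l))
  Lift-Lifting⁻ ↓ ↓′ i s (step Mrm)     l = Lift-[] (s Mrm l)
  Lift-Lifting⁻ ↓ ↓′ i s (mix {m} ns ls n↭) l =
    Lift-mixture⁻ (entries m) ns
      (λ j k → Lift-[]⁻ ↓ (Lift-Lifting⁻ ↓ ↓′ i s (ls j) k)) (Lift-↭ n↭ l)
  Lift-Lifting⁻ ↓ ↓′ i s (resp m≋ n≋ k) l =
    Lift-↭ m≋ (Lift-Lifting⁻ ↓ ↓′ i s k (Lift-↭ (↭-sym n≋) l))

-- Probability of reaching a normal form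

infix 4 _↝_

-- The `⇝E`-steps with a single outcome; the remaining ones are given by `_⇉_`.
data _↝_ : Term → Term → Set₁ where
  surface : M ⇀ M′ → M ↝ M′
  inner   : SurfaceNormal M → M ⇝U M′ → M ↝ M′

⇀⇒¬surfaceNormal : M ⇀ M′ → ¬ SurfaceNormal M
⇀⇒¬surfaceNormal r n = n (_ , byβ (⇀⇒→w r))

⇉⇒¬surfaceNormal : M ⇉ (A , B) → ¬ SurfaceNormal M
⇉⇒¬surfaceNormal c n = n (_ , by⊕ (⇉⇒→⊕ c))

normal⇒surfaceNormal : Normal M → SurfaceNormal M
normal⇒surfaceNormal n (_ , byβ r) = n (_ , byβ (⇝U⇒→β (weak r)))
normal⇒surfaceNormal n (_ , by⊕ c) = n (_ , by⊕ c)

↝⇒¬normal : M ↝ M′ → ¬ Normal M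
↝⇒¬normal (surface r) n = n (_ , byβ (⇝U⇒→β (weak (⇀⇒→w r))))
↝⇒¬normal (inner _ r) n = n (_ , byβ (⇝U⇒→β r))

⇉⇒¬normal : M ⇉ (A , B) → ¬ Normal M
⇉⇒¬normal c n = n (_ , by⊕ (⇉⇒→⊕ c))

↝-diamond : M ↝ A → M ↝ B → A ≡ B ⊎ ∃ λ C → A ↝ C × B ↝ C
↝-diamond (surface r) (surface s) with ⇀-diamond r s
... | inj₁ refl          = inj₁ refl
... | inj₂ (_ , s′ , r′) = inj₂ (_ , surface s′ , surface r′)
↝-diamond (inner n r) (inner _ s) with ⇝U-diamond r s
... | inj₁ refl          = inj₁ refl
... | inj₂ (_ , s′ , r′) =
  inj₂ (_ , inner (⇝U-surfaceNormal n r) s′ , inner (⇝U-surfaceNormal n s) r′)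
↝-diamond (surface r) (inner n _) = contradiction n (⇀⇒¬surfaceNormal r)
↝-diamond (inner n _) (surface r) = contradiction n (⇀⇒¬surfaceNormal r)

⇉-↝-diamond : M ⇉ (A , B) → M ↝ N → ∃₂ λ A′ B′ → A ↝ A′ × B ↝ B′ × N ⇉ (A′ , B′)
⇉-↝-diamond c (surface r) =
  let _ , _ , a , b , c′ = ⇉-⇀-diamond c r in _ , _ , surface a , surface b , c′
⇉-↝-diamond c (inner n _) = contradiction n (⇉⇒¬surfaceNormal c)

½-mono : ∀ {y y′ z z′} → y ≼ y′ → z ≼ z′ → ½ℝ ⊛ y ⊹ ½ℝ ⊛ z ≼ ½ℝ ⊛ y′ ⊹ ½ℝ ⊛ z′
½-mono y≼y′ z≼z′ = ⊹-mono (⊛-monoʳ ½ℝ y≼y′) (⊛-monoʳ ½ℝ z≼z′)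

½-zero : y ≼ 0ℝ → z ≼ 0ℝ → ½ℝ ⊛ y ⊹ ½ℝ ⊛ z ≼ 0ℝ
½-zero y≼0 z≼0 =
  ½-mono y≼0 z≼0 ⨾ ⊹-mono (⊛-zeroʳ ½ℝ) (⊛-zeroʳ ½ℝ) ⨾ ⊹-identityˡ 0ℝ

⊹-interchange : ∀ a b c d → (a ⊹ b) ⊹ (c ⊹ d) ≼ (a ⊹ c) ⊹ (b ⊹ d)
⊹-interchange a b c d =
  ⊹-assoc a b (c ⊹ d) ⨾ ⊹-mono ≼-refl (⊹-exchange b c d) ⨾ ⊹-assoc˘ a c (b ⊹ d)

½-interchange : ∀ a b c d → ½ℝ ⊛ (a ⊹ b) ⊹ ½ℝ ⊛ (c ⊹ d) ≼ ½ℝ ⊛ (a ⊹ c) ⊹ ½ℝ ⊛ (b ⊹ d)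
½-interchange a b c d =
  ⊛-distribˡ˘ ½ℝ (a ⊹ b) (c ⊹ d) ⨾ ⊛-monoʳ ½ℝ (⊹-interchange a b c d)
  ⨾ ⊛-distribˡ ½ℝ (a ⊹ c) (b ⊹ d)

-- Reach N k M x says that some ⇝E-strategy takes M to N within k steps
-- with probability at least x.
data Reach (N : Term) : ℕ → Valuation where
  none  : ∀ {k} → x ≼ 0ℝ → Reach N k M x
  done  : ∀ {k} → M ≡ N → x ≼ 1ℝ → Reach N k M x
  move  : ∀ {k} → M ↝ M′ → Reach N k M′ x → Reach N (suc k) M x
  split : ∀ {k} → M ⇉ (A , B) → Reach N k A y → Reach N k B z →
          x ≼ ½ℝ ⊛ y ⊹ ½ℝ ⊛ z → Reach N (suc k) M x

module _ {N : Term} where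

  Reach-down : ∀ {k} → DownClosed (Reach N k)
  Reach-down x≼y (none y≼)        = none (x≼y ⨾ y≼)
  Reach-down x≼y (done e y≼)      = done e (x≼y ⨾ y≼)
  Reach-down x≼y (move r h)       = move r (Reach-down x≼y h)
  Reach-down x≼y (split c f g y≼) = split c f g (x≼y ⨾ y≼)

  Reach-mono : ∀ {k l} → k ℕ.≤ l → Reach N k M x → Reach N l M x
  Reach-mono k≤l       (none x≼)        = none x≼
  Reach-mono k≤l       (done e x≼)      = done e x≼
  Reach-mono (s≤s k≤l) (move r h)       = move r (Reach-mono k≤l h)
  Reach-mono (s≤s k≤l) (split c f g x≼) =
    split c (Reach-mono k≤l f) (Reach-mono k≤l g) x≼

-- Random descent, and expansion along parallel steps

module _ {N : Term} (N-normal : Normal N) where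

  Reach-zero : ¬ Normal M → Reach N 0 M x → x ≼ 0ℝ
  Reach-zero ¬n (none x≼)     = x≼
  Reach-zero ¬n (done refl _) = contradiction N-normal ¬n

  -- The probability after k steps does not depend on the strategy, since
  -- ⇝E has the diamond property with branches of equal length.

  Reach-move : ∀ {k} → M ↝ A → Reach N (suc k) M x → Reach N k A x
  Reach-move r (none x≼)     = none x≼
  Reach-move r (done refl _) = contradiction N-normal (↝⇒¬normal r)
  Reach-move r (move s h) with ↝-diamond r s
  ... | inj₁ refl = h
  -- No step is left for `h`, and its term still reduces by `r′`, so it is not `N` and the bound is
  -- 0.
  Reach-move {k = zero}  r (move s h) | inj₂ (_ , s′ , r′) =
    none (Reach-zero (↝⇒¬normal r′) h)
  Reach-move {k = suc k} r (move s h) | inj₂ (_ , s′ , r′) = move s′ (Reach-move r′ h)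
  Reach-move {k = zero} r (split c f g x≼) =
    let _ , _ , a , b , _ = ⇉-↝-diamond c r
    in none (x≼ ⨾ ½-zero (Reach-zero (↝⇒¬normal a) f) (Reach-zero (↝⇒¬normal b) g))
  Reach-move {k = suc k} r (split c f g x≼) =
    let _ , _ , a , b , c′ = ⇉-↝-diamond c r
    in split c′ (Reach-move a f) (Reach-move b g) x≼

  Reach-split : ∀ {k} → M ⇉ (A , B) → Reach N (suc k) M x →
                ∃₂ λ y z → Reach N k A y × Reach N k B z × x ≼ ½ℝ ⊛ y ⊹ ½ℝ ⊛ z
  Reach-split c (none x≼) = _ , _ , none ≼-refl , none ≼-refl , x≼ ⨾ 0≼ (½ℝ ⊛ 0ℝ ⊹ ½ℝ ⊛ 0ℝ)
  Reach-split c (done refl _) = contradiction N-normal (⇉⇒¬normal c)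
  Reach-split {k = zero} c (move r h) =
    let _ , _ , _ , _ , c′ = ⇉-↝-diamond c r
    in _ , _ , none ≼-refl , none ≼-refl
     , Reach-zero (⇉⇒¬normal c′) h ⨾ 0≼ (½ℝ ⊛ 0ℝ ⊹ ½ℝ ⊛ 0ℝ)
  Reach-split {k = suc k} c (move r h) =
    let _ , _ , a , b , c′ = ⇉-↝-diamond c r
        _ , _ , f , g , x≼ = Reach-split c′ h
    in _ , _ , move a f , move b g , x≼
  Reach-split c (split d f g x≼) with ⇉-diamond c d
  ... | inj₁ (refl , refl) = _ , _ , f , g , x≼
  Reach-split {k = zero} c (split d f g x≼) | inj₂ (square _ _ l r) =
    _ , _ , none ≼-refl , none ≼-refl
    , x≼ ⨾ ½-mono (Reach-zero (⇉⇒¬normal l) f) (Reach-zero (⇉⇒¬normal r) g)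
  Reach-split {k = suc k} c (split d f g x≼) | inj₂ (square t b l r) =
    let _ , _ , f₁ , f₂ , y≼ = Reach-split l f
        _ , _ , g₁ , g₂ , z≼ = Reach-split r g
    in _ , _ , split t f₁ g₁ ≼-refl , split b f₂ g₂ ≼-refl
     -- Each of the four outcomes has weight 1/4 in either order of the choices; only the grouping
     -- changes.
     , x≼ ⨾ ½-mono y≼ z≼ ⨾ ½-interchange _ _ _ _

  -- Reductions inside M′ only delay the surface steps and, once M′ is
  -- surface normal, preserve its big-step value.

  Reach-⇀* : ∀ {k} → M ⇀* M′ → Reach N k M′ x → ∃ λ l → Reach N l M x
  Reach-⇀* ε        h = _ , h
  Reach-⇀* (r ◅ rs) h = let _ , h′ = Reach-⇀* rs h in _ , move (surface r) h′

  Reach-⇝U* : SurfaceNormal M → M ⇝U* N → x ≼ 1ℝ → ∃ λ k → Reach N k M x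
  Reach-⇝U* n ε        x≼1 = 0 , done refl x≼1
  Reach-⇝U* n (r ◅ rs) x≼1 =
    let _ , h = Reach-⇝U* (⇝U-surfaceNormal n r) rs x≼1 in _ , move (inner n r) h

  -- From a surface-normal term no choice is ever resolved, so the tree is one branch and succeeds
  -- with bound 1 or not at all. The derivation grows backwards from `N ⇓ N`, each `⇝U`-step being a
  -- parallel step.
  Reach-⇓ : ∀ {k} → SurfaceNormal M → Reach N k M x → x ≼ 0ℝ ⊎ (x ≼ 1ℝ × M ⇓ N)
  Reach-⇓ n (none x≼)            = inj₁ x≼
  Reach-⇓ n (done refl x≼)       =
    inj₂ (x≼ , ⇓-βNormal N λ (_ , r) → N-normal (_ , byβ r))
  Reach-⇓ n (move (surface r) h) = contradiction n (⇀⇒¬surfaceNormal r)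
  Reach-⇓ n (split c _ _ _)      = contradiction n (⇉⇒¬surfaceNormal c)
  Reach-⇓ n (move (inner _ r) h) with Reach-⇓ (⇝U-surfaceNormal n r) h
  ... | inj₁ x≼       = inj₁ x≼
  ... | inj₂ (x≼ , e) = inj₂ (x≼ , ∥-⇓ (⇝U⇒∥ r) e)

  -- Induction on the tree of `M′`: a surface step pulls back to `M` after some weak steps, and the
  -- reducts are again related by `∥`. These extra weak steps are why the bound may change from `k`
  -- to `l`.
  Reach-∥ : ∀ {k} → M ∥ M′ → Reach N k M′ x → ∃ λ l → Reach N l M x
  Reach-∥-normal : ∀ {k} → M ∥ M′ → SurfaceNormal M′ → Reach N k M′ x →
                   ∃ λ l → Reach N l M x

  Reach-∥ p (none x≼)       = 0 , none x≼
  Reach-∥ p h@(done refl _) = Reach-∥-normal p (normal⇒surfaceNormal N-normal) h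
  Reach-∥ p h@(move (inner n _) _) = Reach-∥-normal p n h
  Reach-∥ p (move (surface r) h) =
    let _ , rs , i = factor p
        _ , r′ , q = ∥ᵢ-⇀ i r
        _ , h′ = Reach-∥ q h
    in Reach-⇀* rs (move (surface r′) h′)
  Reach-∥ p (split c f g x≼) =
    let _ , rs , i = factor p
        _ , _ , c′ , a , b = ∥ᵢ-⇉ i c
        k , f′ = Reach-∥ a f
        l , g′ = Reach-∥ b g
    in Reach-⇀* rs (split c′ (Reach-mono (ℕ.m≤m⊔n k l) f′)
                             (Reach-mono (ℕ.m≤n⊔m k l) g′) x≼)

  Reach-∥-normal p n h with Reach-⇓ n h
  ... | inj₁ x≼       = 0 , none x≼
  ... | inj₂ (x≼ , e) =
    let _ , rs , i = factor p
        _ , h′ = Reach-⇝U* (surfaceNormal-∥ᵢ⁻ i n) (⇓⇒⇝U* (∥-⇓ (∥ᵢ⇒∥ i) e)) x≼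
    in Reach-⇀* rs h′

  Reachable : Valuation
  Reachable M x = ∃ λ k → Reach N k M x

  -- There are finitely many entries, so the largest of their bounds serves them all.
  Lift-Reachable : Lift Reachable es x → ∃ λ k → Lift (Reach N k) es x
  Lift-Reachable (nil x≼) = 0 , nil x≼
  Lift-Reachable (cons (k , f) h x≼) =
    let l , h′ = Lift-Reachable h
    in k ℕ.⊔ l , cons (Reach-mono (ℕ.m≤m⊔n k l) f)
                      (Lift-map (Reach-mono (ℕ.m≤n⊔m k l)) h′) x≼

  -- A β-step is a parallel step. A choice step is always a surface step, so it becomes the root of
  -- the tree.
  Reachable-⟶ : ∀ {m} → M ⟶ m → Lift Reachable (entries m) x → Reachable M x
  Reachable-⟶ (byβ r) h =
    let _ , h′ = Lift-[]⁻ (λ x≼y → map₂ (Reach-down x≼y)) h in Reach-∥ (→β⇒∥ r) h′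
  Reachable-⟶ (by⊕ c) h with _ , _ , c′ , refl ← →⊕⇒⇉ c =
    let _ , _ , (k , f) , (l , g) , x≼ = Lift-[½]⁻ h
    in _ , split c′ (Reach-mono (ℕ.m≤m⊔n k l) f) (Reach-mono (ℕ.m≤n⊔m k l) g) x≼

  Reachable-⇒ : ∀ {m n} → m ⇒ n → Lift Reachable (entries n) x → Lift Reachable (entries m) x
  Reachable-⇒ = Lift-Lifting⁻ ↓ ↓ (λ _ f → f) Reachable-⟶
    where
    ↓ : DownClosed Reachable
    ↓ x≼y = map₂ (Reach-down x≼y)

  Reach-⇝E : ∀ {k m} → M ⇝E m → Reach N (suc k) M x → Lift (Reach N k) (entries m) x
  Reach-⇝E (surface _ (byβ r)) h = Lift-[] (Reach-move (surface (→w⇒⇀ r)) h)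
  Reach-⇝E (inner n r)         h = Lift-[] (Reach-move (inner n r) h)
  Reach-⇝E (surface _ (by⊕ c)) h with _ , _ , c′ , refl ← →⊕⇒⇉ c =
    let _ , _ , f , g , x≼ = Reach-split c′ h in Lift-≼ x≼ (Lift-[½] f g)

  Reach-idle : ∀ {k} → Normal M → Reach N (suc k) M x → Reach N k M x
  Reach-idle n (none x≼)       = none x≼
  Reach-idle n (done e x≼)     = done e x≼
  Reach-idle n (move r _)      = contradiction n (↝⇒¬normal r)
  Reach-idle n (split c _ _ _) = contradiction n (⇉⇒¬normal c)

  -- Full lifting moves every entry that is not normal, so one unit of the bound is spent everywhere
  -- at once; trees of normal entries contain no steps.
  Reach-⇛E : ∀ {k m n} → m ⇛E n →
             Lift (Reach N (suc k)) (entries m) x → Lift (Reach N k) (entries n) x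
  Reach-⇛E = Lift-Lifting Reach-down Reach-idle Reach-⇝E

  -- With no steps left, the best bound is 1 at `N` and 0 elsewhere; its lifting is the observed
  -- mass of `N`. `Reach-massAt` is the converse.
  massAt-Reach : ∀ es → Lift (Reach N 0) es (massAt es N)
  massAt-Reach [] = nil ≼-refl
  massAt-Reach ((p , M) ∷ es) with M ≟ N
  ... | yes refl = cons (done refl ≼-refl) (massAt-Reach es)
                     (+≼⊹ p _ ⨾ ⊹-mono (⊛-identityʳ˘ p) ≼-refl)
  ... | no  _    = cons (none ≼-refl) (massAt-Reach es) (y≼x⊹y _ _)

  Reach-massAt : ∀ es → Lift (Reach N 0) es x → x ≼ massAt es N
  Reach-massAt [] (nil x≼) = x≼
  Reach-massAt ((p , M) ∷ es) (cons f h x≼) with M ≟ N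
  ... | yes refl =
    x≼ ⨾ ⊹-mono (⊛-monoʳ p (bound f) ⨾ ⊛-identityʳ p) (Reach-massAt es h) ⨾ ⊹≼+ p _
    where
    bound : Reach N 0 M x → x ≼ 1ℝ
    bound (none x≼)   = x≼ ⨾ 0≼ 1ℝ
    bound (done _ x≼) = x≼
  ... | no  M≢N  =
    x≼ ⨾ ⊹-mono (⊛-monoʳ p (bound f) ⨾ ⊛-zeroʳ p) (Reach-massAt es h) ⨾ ⊹-identityˡ _
    where
    bound : Reach N 0 M x → x ≼ 0ℝ
    bound (none x≼)  = x≼
    bound (done e _) = contradiction e M≢N

-- Limits

⇝E⊆⟶ : ∀ {m} → M ⇝E m → M ⟶ m
⇝E⊆⟶ (surface _ (byβ r)) = byβ (⇝U⇒→β (weak r))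
⇝E⊆⟶ (surface _ (by⊕ c)) = by⊕ c
⇝E⊆⟶ (inner _ r)         = byβ (⇝U⇒→β r)

⇛E⊆⇒ : _⇛E_ ⊆ _⇒_
⇛E⊆⇒ (idle _)       = idle tt
⇛E⊆⇒ (step r)       = step (⇝E⊆⟶ r)
⇛E⊆⇒ (mix ns ls n↭) = mix ns (λ i → ⇛E⊆⇒ (ls i)) n↭
⇛E⊆⇒ (resp m≋ n≋ l) = resp m≋ n≋ (⇛E⊆⇒ l)

-- Totality of the strategy

reduct : ∀ M → ∃ λ m → Lifting Normal _⇝E_ [ M ] m
reduct M with ⇝E-progress M
... | inj₁ (m , r) = m , step r
... | inj₂ n       = [ M ] , idle n

total-++ : ∀ es fs → total (es ++ fs) ≼ total es ⊹ total fs
total-++ []             fs = y≼x⊹y _ _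
total-++ ((p , _) ∷ es) fs =
  +≼⊹ p _ ⨾ ⊹-mono ≼-refl (total-++ es fs) ⨾ ⊹-assoc˘ p _ _ ⨾ ⊹-mono (⊹≼+ p _) ≼-refl

total-⊙ : ∀ q es → total (q ⊙ es) ≼ q ⊛ total es
total-⊙ q []             = 0≼ _
total-⊙ q ((p , _) ∷ es) =
  +≼⊹ _ _ ⨾ ⊹-mono (*≼⊛ q p) (total-⊙ q es) ⨾ ⊛-distribˡ˘ q p _ ⨾ ⊛-monoʳ q (⊹≼+ p _)

total-mixture : ∀ es (ns : Fin (length es) → MDist) → total (mixture es ns) ≼ total es
total-mixture []             ns = ≼-refl
total-mixture ((p , _) ∷ es) ns =
  total-++ (p ⊙ entries (ns zero)) _
  ⨾ ⊹-mono (total-⊙ p (entries (ns zero)) ⨾ ⊛-monoʳ p (up (total≤1 (ns zero)))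
             ⨾ ⊛-identityʳ p)
           (total-mixture es (ns ∘ suc))
  ⨾ ⊹≼+ p _

⊙-positive : ∀ {q} → Positive q → ∀ es → All (Positive ∘ proj₁) es →
             All (Positive ∘ proj₁) (q ⊙ es)
⊙-positive         0<q []             []           = []
⊙-positive {q = q} 0<q ((p , _) ∷ es) (0<p ∷ 0<es) =
  *-positive {q} {p} 0<q 0<p ∷ ⊙-positive 0<q es 0<es

mixture-positive : ∀ es (ns : Fin (length es) → MDist) → All (Positive ∘ proj₁) es →
                   All (Positive ∘ proj₁) (mixture es ns)
mixture-positive []       ns []           = []
mixture-positive (_ ∷ es) ns (0<p ∷ 0<es) = All.++⁺
  (⊙-positive 0<p (entries (ns zero)) (positive (ns zero)))
  (mixture-positive es (ns ∘ suc) 0<es)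

-- Hence no multi-distribution is `⇛E`-normal, and a maximal `⇛E`-sequence never stops. In
-- particular it is also maximal for `⇒`.
⇛E-next : ∀ m → ∃ λ n → m ⇛E n
⇛E-next m = n , mix ns (λ i → proj₂ (reduct (proj₂ (lookup (entries m) i)))) ↭-refl
  where
  ns = λ i → proj₁ (reduct (proj₂ (lookup (entries m) i)))
  n = record
    { entries  = mixture (entries m) ns
    ; positive = mixture-positive (entries m) ns (positive m)
    ; total≤1  = λ l → total≤1 m (to-≤ (total-mixture (entries m) ns) l)
    }

evaluate : MDist → ℕ → MDist
evaluate m zero    = m
evaluate m (suc n) = proj₁ (⇛E-next (evaluate m n))

evaluate-maximal : ∀ m → MaximalSequence _⇛E_ m (evaluate m)
evaluate-maximal m = record
  { start = ↭-refl
  ; next  = λ n → inj₁ (proj₂ (⇛E-next (evaluate m n)))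
  }

⇛E-maximal⇒⇒-maximal : ∀ {m s} → MaximalSequence _⇛E_ m s → MaximalSequence _⇒_ m s
⇛E-maximal⇒⇒-maximal {s = s} t = record { start = start ; next = next′ }
  where
  open MaximalSequence t
  next′ : ∀ n → s n ⇒ s (suc n) ⊎ ((¬ ∃ λ n′ → s n ⇒ n′) × s n ≋ s (suc n))
  next′ n with next n
  ... | inj₁ l        = inj₁ (⇛E⊆⇒ l)
  ... | inj₂ (¬l , _) = contradiction (⇛E-next (s n)) ¬l

-- Comparison of reduction sequences

module _ {N : Term} (N-normal : Normal N) where

  Reach-evaluation : ∀ {m s} → MaximalSequence _⇛E_ m s → ∀ n {k} →
    Lift (Reach N (n ℕ.+ k)) (entries m) x → Lift (Reach N k) (entries (s n)) x
  Reach-evaluation t zero h = Lift-↭ (↭-sym (MaximalSequence.start t)) h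
  Reach-evaluation {x = x} {m = m} {s = s} t (suc n) {k} h with MaximalSequence.next t n
  ... | inj₁ l        = Reach-⇛E N-normal l (Reach-evaluation t n
    (subst (λ j → Lift (Reach N j) (entries m) x) (sym (ℕ.+-suc n k)) h))
  ... | inj₂ (¬l , _) = contradiction (⇛E-next (s n)) ¬l

  Reachable-sequence : ∀ {m s} → MaximalSequence _⇒_ m s → ∀ n →
    Lift (Reachable N-normal) (entries (s n)) x → Lift (Reachable N-normal) (entries m) x
  Reachable-sequence t zero    h = Lift-↭ (MaximalSequence.start t) h
  Reachable-sequence t (suc n) h with MaximalSequence.next t n
  ... | inj₁ l       = Reachable-sequence t n (Reachable-⇒ N-normal l h)
  ... | inj₂ (_ , e) = Reachable-sequence t n (Lift-↭ (↭-sym e) h)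

  -- The mass in `s n` is a bound with no steps left. It is pulled back to `m`, where some `k`
  -- suffices, and pushed along `k` steps of `t`; the bound is then used up, so it shows as mass in
  -- `t k`. The index depends on `N`, which is enough for pointwise suprema.
  ⇛E-dominates : ∀ {m s t} → MaximalSequence _⇒_ m s → MaximalSequence _⇛E_ m t →
    ∀ n → ∃ λ k → massAt (entries (s n)) N ≼ massAt (entries (t k)) N
  ⇛E-dominates {s = s} {t} S T n =
    let h = massAt-Reach N-normal (entries (s n))
        k , h′ = Lift-Reachable N-normal (Reachable-sequence S n (Lift-map (0 ,_) h))
        h″ = subst (λ j → Lift (Reach N j) _ _) (sym (ℕ.+-identityʳ k)) h′
    in k , Reach-massAt N-normal (entries (t k)) (Reach-evaluation T k h″)

  massAt-⇛E : ∀ {m n} → m ⇛E n → massAt (entries m) N ≼ massAt (entries n) N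
  massAt-⇛E {m} {n} l = Reach-massAt N-normal (entries n)
    (Reach-⇛E N-normal l (Lift-map (Reach-mono z≤n) (massAt-Reach N-normal (entries m))))

massAt-evaluate : ∀ m {n k} → n ≤′ k → (N : Nnf) →
  mass (obs (evaluate m n)) N ≼ mass (obs (evaluate m k)) N
massAt-evaluate m ≤′-refl         N       = ≼-refl
massAt-evaluate m (≤′-step {k} l) (N , n) =
  massAt-evaluate m l (N , n) ⨾ massAt-⇛E n (proj₂ (⇛E-next (evaluate m k)))

-- Suprema and the denotation

⋃ : (ℕ → ℝ≥0) → ℝ≥0
⋃ xs = record
  { lower    = λ q → ∃ λ n → lower (xs n) q
  ; closed   = λ p<q → map₂ λ {n} → closed (xs n) p<q
  ; rounded  = λ (n , l) → let q , p<q , q∈ = rounded (xs n) l in q , p<q , n , q∈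
  ; negative = λ q<0 → 0 , negative (xs 0) q<0
  }

sum-mono : ∀ {f g : Nnf → ℝ≥0} → (∀ N → f N ≼ g N) → ∀ Ns → sum (map f Ns) ≼ sum (map g Ns)
sum-mono f≼g []       = ≼-refl
sum-mono f≼g (N ∷ Ns) = +≼⊹ _ _ ⨾ ⊹-mono (f≼g N) (sum-mono f≼g Ns) ⨾ ⊹≼+ _ _

-- A finite sum involves finitely many indices, and by monotonicity their maximum works for every
-- summand. Thus the bound 1 on total mass passes to the supremum.
sum-⋃ : (f : ℕ → Nnf → ℝ≥0) → (∀ {n k} → n ≤′ k → ∀ N → f n N ≼ f k N) →
        ∀ Ns {q} → lower (sum (map (λ N → ⋃ λ n → f n N) Ns)) q →
        ∃ λ n → lower (sum (map (f n) Ns)) q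
sum-⋃ f mono []       l = 0 , l
sum-⋃ f mono (N ∷ Ns) (a , b , (n , a∈) , b∈ , q<a+b) =
  let k , b∈′ = sum-⋃ f mono Ns b∈
  in n ℕ.⊔ k , a , b , to-≤ (mono (ℕ.≤⇒≤′ (ℕ.m≤m⊔n n k)) N) a∈
   , to-≤ (sum-mono (mono (ℕ.≤⇒≤′ (ℕ.m≤n⊔m n k))) Ns) b∈′ , q<a+b

⟦_⟧ : MDist → SubDist
⟦ m ⟧ = record
  { mass   = λ N → ⋃ λ n → mass (obs (evaluate m n)) N
  ; mass≤1 = λ Ns u l →
      let n , l′ = sum-⋃ (λ n → mass (obs (evaluate m n))) (massAt-evaluate m) Ns l
      in mass≤1 (obs (evaluate m n)) Ns u l′
  }

⟦⟧-IsSup : ∀ m → IsSup (obs ∘ evaluate m) ⟦ m ⟧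
⟦⟧-IsSup m = (λ n N l → n , l) , λ ν h N (n , l) → h n N l

⟦⟧∈Lim : ∀ m → ⟦ m ⟧ ∈ Lim m _⇛E_
⟦⟧∈Lim m = evaluate m , evaluate-maximal m , ⟦⟧-IsSup m

Lim-⇛E⊆⇒ : ∀ m ρ → ρ ∈ Lim m _⇛E_ → ρ ∈ Lim m _⇒_
Lim-⇛E⊆⇒ m ρ (s , S , sup) = s , ⇛E-maximal⇒⇒-maximal S , sup

-- By domination `ρ` is an upper bound of the observations along `s`, and `μ` is the least one.
Lim-⇒-below-⇛E : ∀ m μ ρ → μ ∈ Lim m _⇒_ → ρ ∈ Lim m _⇛E_ → μ ⊑ ρ
Lim-⇒-below-⇛E m μ ρ (s , S , _ , least) (t , T , upper , _) =
  least ρ λ n (N , normal) l →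
    let k , s≼t = ⇛E-dominates normal S T n in upper k (N , normal) (to-≤ s≼t l)

Lim-⇛E-unique : ∀ m μ ρ → μ ∈ Lim m _⇛E_ → ρ ∈ Lim m _⇛E_ → μ ≐ ρ
Lim-⇛E-unique m μ ρ μ∈ ρ∈ N =
    Lim-⇒-below-⇛E m μ ρ (Lim-⇛E⊆⇒ m μ μ∈) ρ∈ N
  , Lim-⇒-below-⇛E m ρ μ (Lim-⇛E⊆⇒ m ρ ρ∈) μ∈ N

⟦⟧-greatest : ∀ m → IsGreatest (Lim m _⇒_) ⟦ m ⟧
⟦⟧-greatest m = Lim-⇛E⊆⇒ m ⟦ m ⟧ (⟦⟧∈Lim m)
  , λ ν ν∈ → Lim-⇒-below-⇛E m ν ⟦ m ⟧ ν∈ (⟦⟧∈Lim m)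

Lim-⇛E : ∀ m ρ → ρ ∈ Lim m _⇛E_ ⇔ ρ ≐ ⟦ m ⟧
Lim-⇛E m ρ = mk⇔
  (λ ρ∈ → Lim-⇛E-unique m ρ ⟦ m ⟧ ρ∈ (⟦⟧∈Lim m))
  -- Being a supremum is invariant under `≐`, so the fixed evaluation of `m` also witnesses `ρ`.
  (λ ρ≐ → evaluate m , evaluate-maximal m
        , (λ n N {_} l → proj₂ (ρ≐ N) (n , l))
        , λ ν h N {_} l → proj₂ (⟦⟧-IsSup m) ν h N (proj₁ (ρ≐ N) l))

⇛E-normalizing : Normalizing _⇛E_ _⇒_
⇛E-normalizing = ⇛E⊆⇒
  , (λ m μ μ∈ → ⟦ m ⟧ , ⟦⟧∈Lim m , proj₂ (⟦⟧-greatest m) μ μ∈)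
  -- All `⇛E`-limits of `m` coincide, so each of them is maximal.
  , λ m μ μ∈ → μ∈ , λ ν ν∈ _ → Lim-⇛E-unique m ν μ ν∈ μ∈

mainTheorem11 : (∀ (m : MDist) → ∃ λ (⟦m⟧ : SubDist) →
    IsGreatest (Lim m _⇒_) ⟦m⟧
    × (∀ (ρ : SubDist) → (ρ ∈ Lim m _⇛E_) ⇔ (ρ ≐ ⟦m⟧)))
    × Normalizing _⇛E_ _⇒_
mainTheorem11 = (λ m → ⟦ m ⟧ , ⟦⟧-greatest m , Lim-⇛E m) , ⇛E-normalizing
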